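{- Let $L \subseteq 1\{0,1\}^*$. If $L \in \mathrm{NTIME}(2^n)$, then $\mathrm{pad}(L) = \{\mathrm{pad}(w) \mid w \in L\}$ is accepted by a nondeterministic real-time Turing machine.
   Context: For a binary word $w \in 1\{0,1\}^*$ the padded string $\mathrm{pad}(w) \in \{a\}^*$ is defined recursively by $\mathrm{pad}(1) = a$, $\mathrm{pad}(w'0) = \mathrm{pad}(w')^2$ and $\mathrm{pad}(w'1) = \mathrm{pad}(w')^2 a$ (here $u^2 = uu$ denotes concatenation); equivalently $\mathrm{pad}(w) = a^m$ where $m$ is the number with binary representation $w$. $\mathrm{NTIME}(2^n)$ is the class of languages accepted by nondeterministic multitape Turing machines in time $2^n$ on inputs of length $n$. A real-time Turing machine is a (possibly nondeterministic) multitape Turing machine with a one-way read-only input tape and finitely many work tapes which reads one input symbol in every step, so that its computation on an input of length $n$ consists of exactly $n$ steps; it accepts an input if some computation ends, after the whole input has been read, in a final state with empty storage. -}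

module Defs where

open import Data.Nat using (ℕ; zero; suc; _≤_; _^_; _+_)
open import Data.Integer using (ℤ; +_; -[1+_]; 0ℤ; 1ℤ; _≟_) renaming (_+_ to _+ℤ_; _-_ to _-ℤ_)
open import Data.Fin using (Fin; zero; suc)
open import Data.Vec using (Vec; lookup; tabulate)
open import Data.List using (List; []; _∷_; _++_; length)
open import Data.List.Membership.Propositional using (_∈_)
open import Data.Bool using (Bool; true; false; if_then_else_)
open import Data.Unit using (⊤; tt)
open import Data.Product using (Σ; ∃; _×_; _,_)
open import Relation.Nullary.Decidable using (⌊_⌋)
open import Relation.Binary.PropositionalEquality using (_≡_)

data Move : Set where
  left right stay : Move

shift : Move → ℤ → ℤ
shift left  z = z -ℤ 1ℤ
shift right z = z +ℤ 1ℤ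
shift stay  z = z

write : {Γ : Set} → (ℤ → Γ) → ℤ → Γ → (ℤ → Γ)
write f p x z = if ⌊ z ≟ p ⌋ then x else f z

record Config (Q Γ : Set) (k : ℕ) : Set where
  constructor cfg
  field
    state : Q
    tape  : Fin k → ℤ → Γ
    head  : Fin k → ℤ
open Config public

readSyms : {Q Γ : Set} {k : ℕ} → Config Q Γ k → Vec Γ k
readSyms c = tabulate (λ i → tape c i (head c i))

Action : Set → Set → ℕ → Set
Action Q Γ k = Q × Vec Γ k × Vec Move k

apply : {Q Γ : Set} {k : ℕ} → Config Q Γ k → Action Q Γ k → Config Q Γ k
apply c (q′ , ws , ms) =
  cfg q′ (λ i → write (tape c i) (head c i) (lookup ws i))
         (λ i → shift (lookup ms i) (head c i))

-- Nondeterministic multitape Turing machines (input on tape 0)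
-- tape alphabet Fin (3 + extra): 0 = blank, 1 = symbol '0', 2 = symbol '1'

record NTM : Set where
  field
    nStates : ℕ
    nTapes-1 : ℕ
    extra   : ℕ
    start   : Fin nStates
    final   : Fin nStates → Bool
    δ       : Fin nStates → Vec (Fin (3 + extra)) (suc nTapes-1)
              → List (Action (Fin nStates) (Fin (3 + extra)) (suc nTapes-1))

module _ (M : NTM) where
  open NTM M

  Γ : Set
  Γ = Fin (3 + extra)

  NConfig : Set
  NConfig = Config (Fin nStates) Γ (suc nTapes-1)

  enc : Bool → Γ
  enc false = suc zero
  enc true  = suc (suc zero)

  nthSym : List Bool → ℕ → Γ
  nthSym []       _       = zero
  nthSym (b ∷ bs) zero    = enc b
  nthSym (b ∷ bs) (suc n) = nthSym bs n

  inputTape : List Bool → ℤ → Γ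
  inputTape w (+ n)     = nthSym w n
  inputTape w -[1+ n ]  = zero

  initN : List Bool → NConfig
  initN w = cfg start tapes (λ _ → 0ℤ)
    where
      tapes : Fin (suc nTapes-1) → ℤ → Γ
      tapes zero    = inputTape w
      tapes (suc i) = λ _ → zero

  data NStep : NConfig → NConfig → Set where
    nstep : ∀ {c t} → t ∈ δ (state c) (readSyms c) → NStep c (apply c t)

  data NSteps : ℕ → NConfig → NConfig → Set where
    done : ∀ {c} → NSteps zero c c
    next : ∀ {n c c′ c″} → NStep c c′ → NSteps n c′ c″ → NSteps (suc n) c c″

  AcceptsWithin : List Bool → ℕ → Set
  AcceptsWithin w t =
    Σ ℕ λ n → Σ NConfig λ c → n ≤ t × NSteps n (initN w) c × final (state c) ≡ true

InNTIME2^n : (List Bool → Set) → Set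
InNTIME2^n L = Σ NTM λ M → ∀ w →
  (L w → AcceptsWithin M w (2 ^ length w)) × (AcceptsWithin M w (2 ^ length w) → L w)

-- Nondeterministic real-time Turing machines over input alphabet Σ
-- work alphabet Fin (suc extra), 0 = blank; k work tapes

record RTM (Sym : Set) : Set where
  field
    nStates : ℕ
    nWork   : ℕ
    extra   : ℕ
    start   : Fin nStates
    final   : Fin nStates → Bool
    δ       : Fin nStates → Sym → Vec (Fin (suc extra)) nWork
              → List (Action (Fin nStates) (Fin (suc extra)) nWork)

module _ {Sym : Set} (M : RTM Sym) where
  open RTM M

  RConfig : Set
  RConfig = Config (Fin nStates) (Fin (suc extra)) nWork

  initR : RConfig
  initR = cfg start (λ _ _ → zero) (λ _ → 0ℤ)

  data RTRun : RConfig → List Sym → RConfig → Set where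
    end  : ∀ {c} → RTRun c [] c
    read : ∀ {c x xs t c″} → t ∈ δ (state c) x (readSyms c)
           → RTRun (apply c t) xs c″ → RTRun c (x ∷ xs) c″

  RTAccepts : List Sym → Set
  RTAccepts u = Σ RConfig λ c → RTRun initR u c × final (state c) ≡ true
                × (∀ i z → tape c i z ≡ zero)

-- padding, over the unary alphabet {a} represented by ⊤ (a = tt)

padFrom : List ⊤ → List Bool → List ⊤
padFrom u []           = u
padFrom u (false ∷ bs) = padFrom (u ++ u) bs
padFrom u (true ∷ bs)  = padFrom (u ++ u ++ (tt ∷ [])) bs

-- pad(1 bs); words not starting with 1 are outside the domain (junk value)
pad : List Bool → List ⊤
pad []           = []
pad (false ∷ bs) = []
pad (true ∷ bs)  = padFrom (tt ∷ []) bs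

{-# OPTIONS --safe #-}
-- Stack machines without input, in which a step replaces the top of every stack by at most two
-- symbols, can be sped up by any factor 2ᵏ (pairs of symbols become symbols, an odd one waits in
-- the finite control) and then run in real time on tapes, one step per letter of a unary input.
-- It is therefore enough to find a stack machine that accepts exactly at the times 32 · m, where
-- m is the number whose binary representation w lies in L.
--
-- Such a machine guesses w bit by bit and keeps on a clock stack four symbols per unit of the number
-- read so far; appending a bit doubles the clock and possibly adds four symbols, at the exact cost
-- of six steps per symbol gained. Two of the first four symbols are heavy and all added ones are
-- light, so 2^|w| heavy symbols are present at the end. The clock is then run down once, a step of
-- the given machine being simulated only on heavy symbols, which enforces the time bound 2^|w|; the
-- light symbols, which come first, leave time to rewind w. The clock symbols used up are collected
-- on a second stack, and popping these gives time to erase all stacks. In total this takes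
-- 6 + 1 + 1 = 8 steps for each of the 4 · m clock symbols.
module Submission where

open import Defs
open import Algebra.Bundles using (AbelianGroup)
open import Data.Bool using (Bool; true; false; if_then_else_)
open import Data.Empty using (⊥-elim)
open import Data.Fin using (Fin; zero; suc; toℕ; inject₁; #_)
open import Data.Fin.Properties using (toℕ-inject₁)
open import Data.Integer using (ℤ; +_; -[1+_]; 0ℤ; 1ℤ; _≟_) renaming (_+_ to _+ℤ_; _-_ to _-ℤ_; -_ to -ℤ_)
import Data.Integer.Properties as ℤ
open import Algebra.Properties.Group (AbelianGroup.group ℤ.+-0-abelianGroup) using (identityʳ-unique)
open import Data.List using (List; []; _∷_; _++_; _∷ʳ_; _ʳ++_; length; reverse; allFin; cartesianProductWith)
import Data.List as List
open import Data.List.Properties using (length-++; length-map; length-replicate; length-reverse; ++-assoc; ++-identityʳ; reverse-++; reverse-involutive)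
open import Data.List.Membership.Propositional using (_∈_; find; lose)
open import Data.List.Membership.Propositional.Properties using (∈-map⁺; ∈-map⁻; ∈-++⁺ˡ; ∈-++⁺ʳ; ∈-allFin; ∈-cartesianProductWith⁺; ∈-concatMap⁺; ∈-concatMap⁻)
open import Data.List.Relation.Unary.Any using (here; there)
import Data.List.Relation.Unary.Any as Any
open import Data.List.Relation.Unary.Any.Properties using (lookup-index)
open import Data.Maybe using (Maybe; just; nothing; fromMaybe; _<∣>_)
open import Data.Nat using (ℕ; zero; suc; pred; _+_; _*_; _∸_; _^_; _≤_; z≤n; s≤s)
import Data.Nat.Properties as ℕ
open import Data.Nat.Tactic.RingSolver using (solve-∀)
open import Data.Product using (Σ; ∃; _×_; _,_; proj₁; proj₂)
import Data.Product as Product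
open import Data.Sum using (_⊎_; inj₁; inj₂)
open import Data.Unit using (⊤; tt)
open import Data.Vec using (Vec; []; _∷_; lookup; tabulate; map; zipWith; replicate)
open import Data.Vec.Properties using (lookup-map; lookup-zipWith; lookup-replicate; lookup∘tabulate; tabulate∘lookup; tabulate-cong; ∷-injectiveʳ)
open import Data.Vec.Relation.Unary.All as All using (All; []; _∷_)
open import Function using (_∘_)
open import Relation.Nullary using (yes; no)
open import Relation.Binary.PropositionalEquality using (_≡_; _≢_; refl; sym; trans; cong; cong₂; subst; subst₂)

lookup-ext : ∀ {A : Set} {n} {xs ys : Vec A n} → (∀ i → lookup xs i ≡ lookup ys i) → xs ≡ ys
lookup-ext {xs = xs} {ys} eq =
  trans (sym (tabulate∘lookup xs)) (trans (tabulate-cong eq) (tabulate∘lookup ys))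

-- Finite types

record Finite (A : Set) : Set where
  field
    elements : List A
    complete : ∀ x → x ∈ elements

  size : ℕ
  size = length elements

  encode : A → Fin size
  encode x = Any.index (complete x)

  decode : Fin size → A
  decode = List.lookup elements

  decode∘encode : ∀ x → decode (encode x) ≡ x
  decode∘encode x = sym (lookup-index (complete x))

open Finite

finite-× : ∀ {A B : Set} → Finite A → Finite B → Finite (A × B)
finite-× FA FB .elements = cartesianProductWith _,_ (elements FA) (elements FB)
finite-× FA FB .complete (x , y) = ∈-cartesianProductWith⁺ _,_ (complete FA x) (complete FB y)

finite-Maybe : ∀ {A : Set} → Finite A → Finite (Maybe A)
finite-Maybe FA .elements = nothing ∷ List.map just (elements FA)
finite-Maybe FA .complete nothing  = here refl
finite-Maybe FA .complete (just x) = there (∈-map⁺ just (complete FA x))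

finite-Vec : ∀ {A : Set} → Finite A → ∀ n → Finite (Vec A n)
finite-Vec FA zero    .elements = [] ∷ []
finite-Vec FA (suc n) .elements = cartesianProductWith _∷_ (elements FA) (elements (finite-Vec FA n))
finite-Vec FA zero    .complete []       = here refl
finite-Vec FA (suc n) .complete (x ∷ xs) =
  ∈-cartesianProductWith⁺ _∷_ (complete FA x) (complete (finite-Vec FA n) xs)

-- Stack machines

-- The symbols replace the top of the stack; on an empty stack they are just pushed.
data Op (A : Set) : Set where
  pop : Op A
  one : A → Op A
  two : A → A → Op A

opList : ∀ {A : Set} → Op A → List A
opList pop       = []
opList (one x)   = x ∷ []
opList (two x y) = x ∷ y ∷ []

update : ∀ {A : Set} → Op A → List A → List A
update o s = opList o ++ List.drop 1 s

-- Every operation replaces the top, so leaving a stack alone means writing its top back; on an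
-- empty stack `pop` has no effect.
nop : ∀ {A : Set} → Maybe A → Op A
nop nothing  = pop
nop (just x) = one x

push : ∀ {A : Set} → A → Maybe A → Op A
push x nothing  = one x
push x (just y) = two x y

update-nop : ∀ {A : Set} (s : List A) → update (nop (List.head s)) s ≡ s
update-nop []      = refl
update-nop (_ ∷ _) = refl

update-push : ∀ {A : Set} (x : A) s → update (push x (List.head s)) s ≡ x ∷ s
update-push x []      = refl
update-push x (_ ∷ _) = refl

update-nops : ∀ {A : Set} {n} (s : Vec (List A) n) → zipWith update (map nop (map List.head s)) s ≡ s
update-nops []      = refl
update-nops (x ∷ s) = cong₂ _∷_ (update-nop x) (update-nops s)

-- The bound starts at one because `two` puts two symbols on an empty stack. The lemma serves both
-- the windows of the speed-up and the heights of the stacks to be erased.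
update-length : ∀ {A : Set} {n} (o : Op A) s → length s ≤ suc n → length (update o s) ≤ suc (suc n)
update-length pop       []      _       = z≤n
update-length pop       (_ ∷ s) (s≤s p) = ℕ.m≤n⇒m≤1+n (ℕ.m≤n⇒m≤1+n p)
update-length (one _)   []      _       = s≤s z≤n
update-length (one _)   (_ ∷ s) (s≤s p) = s≤s (ℕ.m≤n⇒m≤1+n p)
update-length (two _ _) []      _       = s≤s (s≤s z≤n)
update-length (two _ _) (_ ∷ s) (s≤s p) = s≤s (s≤s p)

record StackMachine : Set₁ where
  field
    Q A     : Set
    finQ    : Finite Q
    finA    : Finite A
    nStacks : ℕ
    start   : Q
    final   : Q → Bool
    δ       : Q → Vec (Maybe A) nStacks → List (Q × Vec (Op A) nStacks)

  Stacks : Set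
  Stacks = Vec (List A) nStacks

  tops : Stacks → Vec (Maybe A) nStacks
  tops = map List.head

  empty : Stacks
  empty = replicate nStacks []

  data Reach : ℕ → Q → Stacks → Set where
    init : Reach 0 start empty
    _▻_  : ∀ {t q s a} → Reach t q s → a ∈ δ q (tops s) → Reach (suc t) (proj₁ a) (zipWith update (proj₂ a) s)

  -- Soundness is stated for runs that end in a final state with any stacks, completeness for runs
  -- that also end with empty stacks; each passes separately through the constructions below.
  AcceptsAt : ℕ → Set
  AcceptsAt t = Σ Q λ q → Σ Stacks λ s → Reach t q s × final q ≡ true

  AcceptsEmptyAt : ℕ → Set
  AcceptsEmptyAt t = Σ Q λ q → Reach t q empty × final q ≡ true

-- Tapes relative to the head

at : {A : Set} → (ℤ → A) → ℤ → ℤ → A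
at f h k = f (h +ℤ k)

writeAt0 : {A : Set} → A → (ℤ → A) → ℤ → A
writeAt0 x g (+ zero)  = x
writeAt0 x g (+ suc j) = g (+ suc j)
writeAt0 x g -[1+ j ]  = g -[1+ j ]

displacement : Move → ℤ
displacement left  = -[1+ 0 ]
displacement right = 1ℤ
displacement stay  = 0ℤ

shift-displacement : ∀ m h → shift m h ≡ h +ℤ displacement m
shift-displacement left  h = refl
shift-displacement right h = refl
shift-displacement stay  h = sym (ℤ.+-identityʳ h)

module _ {A : Set} (f : ℤ → A) (h : ℤ) (x : A) where

  write-here : ∀ z → z ≡ h → write f h x z ≡ x
  write-here z eq with z ≟ h
  ... | yes _ = refl
  ... | no z≢h = ⊥-elim (z≢h eq)

  write-there : ∀ k → k ≢ 0ℤ → write f h x (h +ℤ k) ≡ f (h +ℤ k)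
  write-there k k≢0 with (h +ℤ k) ≟ h
  ... | yes eq = ⊥-elim (k≢0 (identityʳ-unique h k eq))
  ... | no _ = refl

  write-at : ∀ k → at (write f h x) h k ≡ writeAt0 x (at f h) k
  write-at (+ zero)  = write-here (h +ℤ 0ℤ) (ℤ.+-identityʳ h)
  write-at (+ suc j) = write-there (+ suc j) λ ()
  write-at -[1+ j ]  = write-there -[1+ j ] λ ()

  -- Relative to the head, a step overwrites offset 0 and then translates. For a concrete move and
  -- offset the right-hand side computes, so each case of a tape update becomes one instance.
  move-at : ∀ m k → at (write f h x) (shift m h) k ≡ writeAt0 x (at f h) (displacement m +ℤ k)
  move-at m k = trans
    (cong (write f h x)
      (trans (cong (_+ℤ k) (shift-displacement m h)) (ℤ.+-assoc h (displacement m) k)))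
    (write-at (displacement m +ℤ k))

at-surjective : ∀ h z → ∃ λ k → z ≡ h +ℤ k
at-surjective h z = z -ℤ h , sym (trans (ℤ.+-comm h (z -ℤ h))
  (trans (ℤ.+-assoc z (-ℤ h) h) (trans (cong (z +ℤ_) (ℤ.+-inverseˡ h)) (ℤ.+-identityʳ z))))

nth : ∀ {A : Set} → List A → ℕ → Maybe A
nth []       _       = nothing
nth (x ∷ xs) zero    = just x
nth (x ∷ xs) (suc n) = nth xs n

nth-head : ∀ {A : Set} (s : List A) → nth s 0 ≡ List.head s
nth-head []      = refl
nth-head (_ ∷ _) = refl

nth-suc : ∀ {A : Set} (s : List A) j → nth s (suc j) ≡ nth (List.drop 1 s) j
nth-suc []      j = refl
nth-suc (_ ∷ _) j = refl

-- Stack machines in real time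

module Compile (S : StackMachine) where
  open StackMachine S

  finState : Finite (Q × Vec (Maybe A) nStacks)
  finState = finite-× finQ (finite-Vec (finite-Maybe finA) nStacks)

  Cell : Set
  Cell = Fin (suc (size finA))

  cell : Maybe A → Cell
  cell nothing  = zero
  cell (just x) = suc (encode finA x)

  uncell : Cell → Maybe A
  uncell zero    = nothing
  uncell (suc i) = just (decode finA i)

  uncell∘cell : ∀ m → uncell (cell m) ≡ m
  uncell∘cell nothing  = refl
  uncell∘cell (just x) = cong just (decode∘encode finA x)

  -- An operation overwrites the old top, so the new held symbol, the written cell and the move
  -- depend on the operation alone, not on whether the old top was held or under the head.
  held : Op A → Maybe A
  held pop       = nothing
  held (one x)   = nothing
  held (two x y) = just x

  written : Op A → Cell
  written pop       = zero
  written (one x)   = cell (just x)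
  written (two x y) = cell (just y)

  moved : Op A → Move
  moved pop       = left
  moved (one x)   = stay
  moved (two x y) = right

  action : Q × Vec (Op A) nStacks → Action (Fin (size finState)) Cell nStacks
  action (q , ops) = encode finState (q , map held ops) , map written ops , map moved ops

  visible : Vec (Maybe A) nStacks → Vec Cell nStacks → Vec (Maybe A) nStacks
  visible = zipWith (λ hd c → hd <∣> uncell c)

  rtm : RTM ⊤
  rtm = record
    { nStates = size finState
    ; nWork   = nStacks
    ; extra   = size finA
    ; start   = encode finState (start , replicate nStacks nothing)
    ; final   = λ i → final (proj₁ (decode finState i))
    ; δ       = λ i _ cells → let (q , hs) = decode finState i in List.map action (δ q (visible hs cells))
    }

  -- The stack grows to the right, its top being either under the head or held in the finite
  -- control above a blank cell; so a push need not visit two cells.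
  Here : Maybe A → Cell → Maybe A → Set
  Here nothing  c t = c ≡ cell t
  Here (just x) c t = c ≡ zero × t ≡ just x

  record Represents (f : ℤ → Cell) (h : ℤ) (hd : Maybe A) (s : List A) : Set where
    field
      above : ∀ j → at f h (+ suc j) ≡ zero
      top   : Here hd (at f h 0ℤ) (List.head s)
      below : ∀ j → at f h -[1+ j ] ≡ cell (nth (List.drop 1 s) j)
  open Represents

  represents-visible : ∀ {f h hd s} → Represents f h hd s → hd <∣> uncell (f h) ≡ List.head s
  represents-visible {f} {h} {nothing} {s} R =
    trans (cong (uncell ∘ f) (sym (ℤ.+-identityʳ h))) (trans (cong uncell (top R)) (uncell∘cell _))
  represents-visible {hd = just x} R = sym (proj₂ (top R))

  represents-update : ∀ {f h hd s} o → Represents f h hd s →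
    Represents (write f h (written o)) (shift (moved o) h) (held o) (update o s)
  represents-update {f} {h} {s = s} pop R .above zero = move-at f h zero left (+ 1)
  represents-update {f} {h} {s = s} pop R .above (suc j) = trans (move-at f h zero left (+ suc (suc j))) (above R j)
  represents-update {f} {h} {s = s} pop R .top =
    trans (move-at f h zero left (+ 0)) (trans (below R 0) (cong cell (nth-head (List.drop 1 s))))
  represents-update {f} {h} {s = s} pop R .below j =
    trans (move-at f h zero left -[1+ j ]) (trans (below R (suc j)) (cong cell (nth-suc (List.drop 1 s) j)))
  represents-update {f} {h} (one x) R .above j = trans (move-at f h _ stay (+ suc j)) (above R j)
  represents-update {f} {h} (one x) R .top     = move-at f h _ stay (+ 0)
  represents-update {f} {h} (one x) R .below j = trans (move-at f h _ stay -[1+ j ]) (below R j)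
  represents-update {f} {h} (two x y) R .above j = trans (move-at f h _ right (+ suc j)) (above R (suc j))
  represents-update {f} {h} (two x y) R .top     = trans (move-at f h _ right (+ 0)) (above R 0) , refl
  represents-update {f} {h} (two x y) R .below zero    = move-at f h _ right -[1+ 0 ]
  represents-update {f} {h} (two x y) R .below (suc j) = trans (move-at f h _ right -[1+ suc j ]) (below R j)

  -- With an empty stack the cells below encode `nothing`, and the cell under the head is blank in
  -- either case of `Here`. This turns empty stacks into empty storage.
  represents-empty : ∀ {f h hd} → Represents f h hd [] → ∀ z → f z ≡ zero
  represents-empty {f} {h} {hd} R z with at-surjective h z
  ... | (+ suc j) , refl = above R j
  ... | -[1+ j ] , refl  = below R j
  ... | (+ zero) , refl  = blank hd (top R)
    where
      blank : ∀ m → Here m (at f h 0ℤ) nothing → at f h 0ℤ ≡ zero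
      blank nothing  eq       = eq
      blank (just _) (eq , _) = eq

  record Simulates (c : RConfig rtm) (q : Q) (s : Stacks) : Set where
    constructor simulates
    field
      {holds}  : Vec (Maybe A) nStacks
      state-eq : state c ≡ encode finState (q , holds)
      tape-rep : ∀ i → Represents (tape c i) (head c i) (lookup holds i) (lookup s i)

  initially : Simulates (initR rtm) start empty
  initially = simulates refl λ i →
    subst₂ (Represents _ _) (sym (lookup-replicate i nothing)) (sym (lookup-replicate i []))
      record { above = λ _ → refl ; top = refl ; below = λ _ → refl }

  -- An equality of lists, so that membership can be transported both ways, for soundness and for
  -- completeness.
  transitions : ∀ {c q s} → Simulates c q s → RTM.δ rtm (state c) tt (readSyms c) ≡ List.map action (δ q (tops s))
  transitions {c} {q} {s} (simulates {hs} eq rep)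
    rewrite eq | decode∘encode finState (q , hs) = cong (List.map action ∘ δ q) (lookup-ext λ i →
      trans (lookup-zipWith _ i hs (readSyms c))
      (trans (cong (λ c → lookup hs i <∣> uncell c) (lookup∘tabulate _ i))
      (trans (represents-visible (rep i)) (sym (lookup-map i List.head s)))))

  advance : ∀ {c q s} a → Simulates c q s → Simulates (apply c (action a)) (proj₁ a) (zipWith update (proj₂ a) s)
  advance {c} {q} {s} (q′ , ops) (simulates eq rep) = simulates refl λ i →
    transport (lookup-map i written ops) (lookup-map i moved ops) (lookup-map i held ops)
      (lookup-zipWith update i ops s) (represents-update (lookup ops i) (rep i))
    where
      transport : ∀ {f h x x′ m m′ hd hd′ s s′} → x′ ≡ x → m′ ≡ m → hd′ ≡ hd → s′ ≡ s →
        Represents (write f h x) (shift m h) hd s → Represents (write f h x′) (shift m′ h) hd′ s′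
      transport refl refl refl refl R = R

  run-sound : ∀ {c q s t u c′} → Reach t q s → Simulates c q s → RTRun rtm c u c′ →
    Σ Q λ q′ → Σ Stacks λ s′ → Reach (length u + t) q′ s′ × Simulates c′ q′ s′
  run-sound r sim end = _ , _ , r , sim
  run-sound {t = t} r sim (read {xs = xs} a∈ run) with ∈-map⁻ action (subst (_ ∈_) (transitions sim) a∈)
  ... | a , a∈δ , refl with run-sound (r ▻ a∈δ) (advance a sim) run
  ... | q′ , s′ , r′ , sim′ = q′ , s′ , subst (λ n → Reach n q′ s′) (ℕ.+-suc (length xs) t) r′ , sim′

  -- `Reach` grows at the end of a run, `RTRun` at its front.
  run-snoc : ∀ {c u c′ x a} → RTRun rtm c u c′ → a ∈ RTM.δ rtm (state c′) x (readSyms c′) →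
    RTRun rtm c (u ∷ʳ x) (apply c′ a)
  run-snoc end         a∈ = read a∈ end
  run-snoc (read b∈ r) a∈ = read b∈ (run-snoc r a∈)

  run-complete : ∀ {t q s} → Reach t q s →
    Σ (List ⊤) λ u → Σ (RConfig rtm) λ c → length u ≡ t × RTRun rtm (initR rtm) u c × Simulates c q s
  run-complete init = [] , _ , refl , end , initially
  run-complete (_▻_ {a = a} r a∈) with run-complete r
  ... | u , c , refl , run , sim =
    u ∷ʳ tt , _ , trans (length-++ u) (ℕ.+-comm (length u) 1) ,
    run-snoc run (subst (action a ∈_) (sym (transitions sim)) (∈-map⁺ action a∈)) , advance a sim

  final-eq : ∀ {c q s} → Simulates c q s → RTM.final rtm (state c) ≡ final q
  final-eq (simulates {hs} eq _) =
    trans (cong (RTM.final rtm) eq) (cong (final ∘ proj₁) (decode∘encode finState (_ , hs)))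

  rtm-sound : ∀ u → RTAccepts rtm u → AcceptsAt (length u)
  rtm-sound u (c , run , fin , _) with run-sound init initially run
  ... | q , s , r , sim = q , s , subst (λ n → Reach n q s) (ℕ.+-identityʳ (length u)) r , trans (sym (final-eq sim)) fin

  rtm-complete : ∀ t → AcceptsEmptyAt t → Σ (List ⊤) λ u → length u ≡ t × RTAccepts rtm u
  rtm-complete t (q , r , fin) with run-complete r
  ... | u , c , len , run , sim = u , len , c , run , trans (final-eq sim) fin , λ i →
    represents-empty (subst (Represents _ _ _) (lookup-replicate i []) (Simulates.tape-rep sim i))

-- Speed-up of stack machines

module _ {A : Set} where

  flatten : List (A × A) → List A
  flatten []            = []
  flatten ((x , y) ∷ s) = x ∷ y ∷ flatten s

  unpack : Maybe A → List (A × A) → List A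
  unpack nothing  s = flatten s
  unpack (just x) s = x ∷ flatten s

  window : Maybe A → Maybe (A × A) → List A
  window b m = unpack b (List.fromMaybe m)

  -- Longer lists do not occur: a window has at most three symbols and two steps add at most two.
  pack : List A → Maybe A × Op (A × A)
  pack []                        = nothing , pop
  pack (a ∷ [])                  = just a  , pop
  pack (a ∷ b ∷ [])              = nothing , one (a , b)
  pack (a ∷ b ∷ c ∷ [])          = just a  , one (b , c)
  pack (a ∷ b ∷ c ∷ d ∷ [])      = nothing , two (a , b) (c , d)
  pack (a ∷ b ∷ c ∷ d ∷ e ∷ _)   = just a  , two (b , c) (d , e)

  unpack-pack : ∀ y s → length y ≤ 5 →
    y ++ flatten (List.drop 1 s) ≡ unpack (proj₁ (pack y)) (update (proj₂ (pack y)) s)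
  unpack-pack []                          s _ = refl
  unpack-pack (_ ∷ [])                    s _ = refl
  unpack-pack (_ ∷ _ ∷ [])                s _ = refl
  unpack-pack (_ ∷ _ ∷ _ ∷ [])            s _ = refl
  unpack-pack (_ ∷ _ ∷ _ ∷ _ ∷ [])        s _ = refl
  unpack-pack (_ ∷ _ ∷ _ ∷ _ ∷ _ ∷ [])    s _ = refl
  unpack-pack (_ ∷ _ ∷ _ ∷ _ ∷ _ ∷ _ ∷ _) s (s≤s (s≤s (s≤s (s≤s (s≤s ())))))

  -- Enough of the stack `x ++ rest` is visible for n steps: a step uses up at most one symbol, so
  -- either `x` has n of them or nothing lies beneath.
  Covers : ℕ → List A → List A → Set
  Covers n x rest = n ≤ length x ⊎ rest ≡ []

  head-++ : ∀ x {rest} → Covers 1 x rest → List.head (x ++ rest) ≡ List.head x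
  head-++ []      (inj₂ refl) = refl
  head-++ (_ ∷ _) _           = refl

  update-++ : ∀ o x {rest} → Covers 1 x rest → update o (x ++ rest) ≡ update o x ++ rest
  update-++ o (_ ∷ x) {rest} _ = sym (++-assoc (opList o) x rest)
  update-++ o []      (inj₂ refl) = sym (++-identityʳ (opList o ++ []))

  covers-update : ∀ {n} o x {rest} → Covers (suc n) x rest → Covers n (update o x) rest
  covers-update o x (inj₂ eq) = inj₂ eq
  covers-update o (_ ∷ x) (inj₁ (s≤s le)) = inj₁ (ℕ.≤-trans le
    (ℕ.≤-trans (ℕ.m≤n+m (length x) (length (opList o))) (ℕ.≤-reflexive (sym (length-++ (opList o))))))

  covers-weaken : ∀ x {rest} → Covers 2 x rest → Covers 1 x rest
  covers-weaken _ (inj₁ le) = inj₁ (ℕ.≤-trans (s≤s z≤n) le)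
  covers-weaken _ (inj₂ eq) = inj₂ eq

  -- A top pair already supplies two symbols; without a pair the window is the whole stack.
  window-covers : ∀ b s → Covers 2 (window b (List.head s)) (flatten (List.drop 1 s))
  window-covers b        []      = inj₂ refl
  window-covers nothing  (_ ∷ _) = inj₁ (s≤s (s≤s z≤n))
  window-covers (just _) (_ ∷ _) = inj₁ (s≤s (s≤s z≤n))

  window-length : ∀ b m → length (window b m) ≤ 3
  window-length nothing  nothing  = z≤n
  window-length nothing  (just _) = s≤s (s≤s z≤n)
  window-length (just _) nothing  = s≤s z≤n
  window-length (just _) (just _) = s≤s (s≤s (s≤s z≤n))

  unpack-window : ∀ b s → unpack b s ≡ window b (List.head s) ++ flatten (List.drop 1 s)
  unpack-window nothing  []      = refl
  unpack-window nothing  (_ ∷ _) = refl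
  unpack-window (just _) []      = refl
  unpack-window (just _) (_ ∷ _) = refl

  head-window : ∀ b s → List.head (unpack b s) ≡ List.head (window b (List.head s))
  head-window b s rewrite unpack-window b s =
    head-++ (window b (List.head s)) (covers-weaken (window b (List.head s)) (window-covers b s))

  update-window : ∀ b s o → update o (unpack b s) ≡ update o (window b (List.head s)) ++ flatten (List.drop 1 s)
  update-window b s o = trans (cong (update o) (unpack-window b s)) 
    (update-++ o (window b (List.head s)) (covers-weaken (window b (List.head s)) (window-covers b s)))

  head-update-window : ∀ b s o → List.head (update o (unpack b s)) ≡ List.head (update o (window b (List.head s)))
  head-update-window b s o = trans (cong List.head (update-window b s o))
    (head-++ (update o (window b (List.head s))) (covers-update o (window b (List.head s)) (window-covers b s)))

  -- Two steps stay within the window and turn it into at most 3 + 2 symbols, which `pack` splits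
  -- into an odd symbol and at most two pairs replacing the old top pair.
  update²-window : ∀ b s o o′ → let p = pack (update o′ (update o (window b (List.head s)))) in
    update o′ (update o (unpack b s)) ≡ unpack (proj₁ p) (update (proj₂ p) s)
  update²-window b s o o′ =
    trans (cong (update o′) (update-window b s o))
    (trans (update-++ o′ (update o w) (covers-update o w (window-covers b s)))
    (unpack-pack (update o′ (update o w)) s (update-length o′ (update o w) (update-length o w (window-length b (List.head s))))))
    where
      w : List A
      w = window b (List.head s)

  unpacks : ∀ {n} → Vec (Maybe A) n → Vec (List (A × A)) n → Vec (List A) n
  unpacks = zipWith unpack

  windows : ∀ {n} → Vec (Maybe A) n → Vec (Maybe (A × A)) n → Vec (List A) n
  windows = zipWith window

  updates : ∀ {n} → Vec (Op A) n → Vec (List A) n → Vec (List A) n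
  updates = zipWith update

  tops-windows : ∀ {n} (bs : Vec _ n) ss → map List.head (unpacks bs ss) ≡ map List.head (windows bs (map List.head ss))
  tops-windows []       []       = refl
  tops-windows (b ∷ bs) (s ∷ ss) = cong₂ _∷_ (head-window b s) (tops-windows bs ss)

  tops-update-windows : ∀ {n} (bs : Vec _ n) ss os →
    map List.head (updates os (unpacks bs ss)) ≡ map List.head (updates os (windows bs (map List.head ss)))
  tops-update-windows []       []       []       = refl
  tops-update-windows (b ∷ bs) (s ∷ ss) (o ∷ os) = cong₂ _∷_ (head-update-window b s o) (tops-update-windows bs ss os)

  updates²-windows : ∀ {n} (bs : Vec _ n) ss os os′ →
    let ps = map pack (updates os′ (updates os (windows bs (map List.head ss)))) in
    updates os′ (updates os (unpacks bs ss)) ≡ unpacks (map proj₁ ps) (zipWith update (map proj₂ ps) ss)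
  updates²-windows []       []       []       []         = refl
  updates²-windows (b ∷ bs) (s ∷ ss) (o ∷ os) (o′ ∷ os′) =
    cong₂ _∷_ (update²-window b s o o′) (updates²-windows bs ss os os′)

  unpacks-nothing : ∀ n → unpacks (replicate n nothing) (replicate n []) ≡ replicate n []
  unpacks-nothing zero    = refl
  unpacks-nothing (suc n) = cong ([] ∷_) (unpacks-nothing n)

  unpacks-empty : ∀ {n} (bs : Vec _ n) ss → unpacks bs ss ≡ replicate n [] → ss ≡ replicate n []
  unpacks-empty []             []             eq = refl
  unpacks-empty (nothing ∷ bs) ([] ∷ ss)      eq = cong ([] ∷_) (unpacks-empty bs ss (∷-injectiveʳ eq))
  unpacks-empty (just _  ∷ bs) (_ ∷ ss)       ()
  unpacks-empty (nothing ∷ bs) ((_ ∷ _) ∷ ss) ()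

module SpeedUp (S : StackMachine) where
  open StackMachine S

  finish : Q × Vec (Op A) nStacks → Stacks → (Q × Vec (Maybe A) nStacks) × Vec (Op (A × A)) nStacks
  finish (q , os) ws = let ps = map pack (updates os ws) in (q , map proj₁ ps) , map proj₂ ps

  second : Stacks → Q × Vec (Op A) nStacks → List ((Q × Vec (Maybe A) nStacks) × Vec (Op (A × A)) nStacks)
  second ws (q , os) = let ws′ = updates os ws in List.map (λ a → finish a ws′) (δ q (tops ws′))

  fast : StackMachine
  fast = record
    { Q       = Q × Vec (Maybe A) nStacks
    ; A       = A × A
    ; finQ    = finite-× finQ (finite-Vec (finite-Maybe finA) nStacks)
    ; finA    = finite-× finA finA
    ; nStacks = nStacks
    ; start   = start , replicate nStacks nothing
    ; final   = final ∘ proj₁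
    ; δ       = λ (q , bs) ms → let ws = windows bs ms in List.concatMap (second ws) (δ q (tops ws))
    }
  module Fast = StackMachine fast

  fast-sound : ∀ {t q bs ss} → Fast.Reach t (q , bs) ss → Reach (t * 2) q (unpacks bs ss)
  fast-sound Fast.init = subst (Reach 0 start) (sym (unpacks-nothing nStacks)) init
  fast-sound (Fast._▻_ {q = q , bs} {s = ss} r a∈)
    with find (∈-concatMap⁻ (second ws) {xs = δ q (tops ws)} a∈)
    where
      ws : Stacks
      ws = windows bs (map List.head ss)
  ... | (q₁ , os) , a₁∈ , a∈₂ with ∈-map⁻ _ a∈₂
  ... | (q₂ , os′) , a₂∈ , refl =
    subst (Reach _ q₂) (updates²-windows bs ss os os′)
      ((fast-sound r ▻ subst (λ v → (q₁ , os) ∈ δ q v) (sym (tops-windows bs ss)) a₁∈)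
        ▻ subst (λ v → (q₂ , os′) ∈ δ q₁ v) (sym (tops-update-windows bs ss os)) a₂∈)

  fast-complete : ∀ t {q s} → Reach (t * 2) q s →
    ∃ λ bs → ∃ λ ss → s ≡ unpacks bs ss × Fast.Reach t (q , bs) ss
  fast-complete zero init = _ , _ , sym (unpacks-nothing nStacks) , Fast.init
  -- `suc t * 2` computes to two successors, so the last two slow steps are exposed together and
  -- form one fast step.
  fast-complete (suc t) (_▻_ {a = q₂ , os′} (_▻_ {q = q} {a = q₁ , os} r a₁∈) a₂∈) with fast-complete t r
  ... | bs , ss , refl , r′ = _ , _ , updates²-windows bs ss os os′ ,
    (r′ Fast.▻ ∈-concatMap⁺ (second ws)
      (lose (subst (λ v → (q₁ , os) ∈ δ q v) (tops-windows bs ss) a₁∈)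
            (∈-map⁺ (λ a → finish a (updates os ws))
              (subst (λ v → (q₂ , os′) ∈ δ q₁ v) (tops-update-windows bs ss os) a₂∈))))
    where
      ws : Stacks
      ws = windows bs (map List.head ss)

  accepts-sound : ∀ t → Fast.AcceptsAt t → AcceptsAt (t * 2)
  accepts-sound t ((q , bs) , ss , r , fin) = q , unpacks bs ss , fast-sound r , fin

  accepts-complete : ∀ t → AcceptsEmptyAt (t * 2) → Fast.AcceptsEmptyAt t
  accepts-complete t (q , r , fin) with fast-complete t r
  ... | bs , ss , eq , r′ = (q , bs) , subst (Fast.Reach t _) (unpacks-empty bs ss (sym eq)) r′ , fin

-- Iterated speed-up

speedUp : ℕ → StackMachine → StackMachine
speedUp zero    S = S
speedUp (suc n) S = SpeedUp.fast (speedUp n S)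

speedUp-sound : ∀ n S t → StackMachine.AcceptsAt (speedUp n S) t → StackMachine.AcceptsAt S (t * 2 ^ n)
speedUp-sound zero    S t acc = subst (StackMachine.AcceptsAt S) (sym (ℕ.*-identityʳ t)) acc
speedUp-sound (suc n) S t acc = subst (StackMachine.AcceptsAt S) (ℕ.*-assoc t 2 (2 ^ n))
  (speedUp-sound n S (t * 2) (SpeedUp.accepts-sound (speedUp n S) t acc))

speedUp-complete : ∀ n S t → StackMachine.AcceptsEmptyAt S (t * 2 ^ n) → StackMachine.AcceptsEmptyAt (speedUp n S) t
speedUp-complete zero    S t acc = subst (StackMachine.AcceptsEmptyAt S) (ℕ.*-identityʳ t) acc
speedUp-complete (suc n) S t acc = SpeedUp.accepts-complete (speedUp n S) t (speedUp-complete n S (t * 2)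
  (subst (StackMachine.AcceptsEmptyAt S) (sym (ℕ.*-assoc t 2 (2 ^ n))) acc))

record RealTime (k : ℕ) (S : StackMachine) : Set where
  field
    acceptor     : RTM ⊤
    accepts-only : ∀ u → RTAccepts acceptor u → StackMachine.AcceptsAt S (length u * 2 ^ k)
    accepts-all  : ∀ t → StackMachine.AcceptsEmptyAt S (t * 2 ^ k) → ∃ λ u → length u ≡ t × RTAccepts acceptor u

realTime : ∀ k S → RealTime k S
realTime k S = record
  { acceptor     = Compile.rtm (speedUp k S)
  ; accepts-only = λ u acc → speedUp-sound k S (length u) (Compile.rtm-sound (speedUp k S) u acc)
  ; accepts-all  = λ t acc → Compile.rtm-complete (speedUp k S) t (speedUp-complete k S t acc)
  }

-- Simulating a Turing machine against a clock

double : ℕ → ℕ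
double zero    = zero
double (suc n) = suc (suc (double n))

module _ {A : Set} where

  interleave : ∀ {n} → Vec (A × A) n → Vec A (double n)
  interleave []             = []
  interleave ((x , y) ∷ xs) = x ∷ y ∷ interleave xs

  uninterleave : ∀ n → Vec A (double n) → Vec (A × A) n
  uninterleave zero    []           = []
  uninterleave (suc n) (x ∷ y ∷ xs) = (x , y) ∷ uninterleave n xs

  interleave-replicate : ∀ n (x : A) → interleave (replicate n (x , x)) ≡ replicate (double n) x
  interleave-replicate zero    x = refl
  interleave-replicate (suc n) x = cong (λ v → x ∷ x ∷ v) (interleave-replicate n x)

uninterleave-map : ∀ {A B : Set} {n} (f : A → B) (xs : Vec (A × A) n) →
  uninterleave n (map f (interleave xs)) ≡ map (Product.map f f) xs
uninterleave-map f []             = refl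
uninterleave-map f ((x , y) ∷ xs) = cong (_ ∷_) (uninterleave-map f xs)

lookup-uninterleave-map : ∀ {A B : Set} {n} (f : A → B) (xs : Vec (A × A) n) i →
  lookup (uninterleave n (map f (interleave xs))) i ≡ Product.map f f (lookup xs i)
lookup-uninterleave-map f xs i =
  trans (cong (λ v → lookup v i) (uninterleave-map f xs)) (lookup-map i (Product.map f f) xs)

zipWith-interleave : ∀ {A B C : Set} {n} (f : A → B → C) (xs : Vec (A × A) n) ys →
  zipWith f (interleave xs) (interleave ys) ≡ interleave (zipWith (λ (a , a′) (b , b′) → f a b , f a′ b′) xs ys)
zipWith-interleave f []       []       = refl
zipWith-interleave f (_ ∷ xs) (_ ∷ ys) = cong (λ v → _ ∷ _ ∷ v) (zipWith-interleave f xs ys)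

-- Doubled lists and the lengths of padded words

module _ {A : Set} where

  twice : List A → List A
  twice []      = []
  twice (x ∷ s) = x ∷ x ∷ twice s

  -- The two copies of a symbol are equal and adjacent, so reversal respects doubling; this is why
  -- moving the clock over and back restores its order.
  twice-ʳ++ : ∀ s {s′} → twice s ʳ++ twice s′ ≡ twice (s ʳ++ s′)
  twice-ʳ++ []      = refl
  twice-ʳ++ (x ∷ s) = twice-ʳ++ s

  length-twice : ∀ s → length (twice s) ≡ length s * 2
  length-twice []      = refl
  length-twice (x ∷ s) = cong (λ n → suc (suc n)) (length-twice s)

  pushes : ℕ → A → List A → List A
  pushes zero    x s = s
  pushes (suc n) x s = pushes n x (x ∷ s)

  length-pushes : ∀ n x s → length (pushes n x s) ≡ n + length s
  length-pushes zero    x s = refl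
  length-pushes (suc n) x s = trans (length-pushes n x (x ∷ s)) (ℕ.+-suc n (length s))

-- Bits are listed in reverse and without the leading one.
value : List Bool → ℕ
value []          = 1
value (false ∷ r) = value r * 2
value (true ∷ r)  = suc (value r * 2)

-- Generalised to an accumulator: `u` stands for the bits `r` read so far, the latest first, hence
-- the reversing append.
length-padFrom : ∀ u r bs → length u ≡ value r → length (padFrom u bs) ≡ value (bs ʳ++ r)
length-padFrom u r []           eq = eq
length-padFrom u r (false ∷ bs) eq = length-padFrom (u ++ u) (false ∷ r) bs
  (trans (length-++ u) (trans (cong₂ _+_ eq eq) (double-sum (value r))))
  where
    double-sum : ∀ n → n + n ≡ n * 2
    double-sum = solve-∀
length-padFrom u r (true ∷ bs)  eq = length-padFrom (u ++ u ++ (tt ∷ [])) (true ∷ r) bs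
  (trans (length-++ u) (trans (cong₂ _+_ eq (trans (length-++ u) (cong (_+ 1) eq))) (double-sum (value r))))
  where
    double-sum : ∀ n → n + (n + 1) ≡ suc (n * 2)
    double-sum = solve-∀

wordOf : List Bool → List Bool
wordOf r = true ∷ reverse r

length-pad : ∀ r → length (pad (wordOf r)) ≡ value r
length-pad r = trans (length-padFrom (tt ∷ []) [] (reverse r) refl) (cong value (reverse-involutive r))

unary-≡ : ∀ {u v : List ⊤} → length u ≡ length v → u ≡ v
unary-≡ {[]}    {[]}    _  = refl
unary-≡ {_ ∷ u} {_ ∷ v} eq = cong (tt ∷_) (unary-≡ (ℕ.suc-injective eq))

-- The stack machine simulating `M`

module Simulation (M : NTM) where
  module N = NTM M

  Symbol : Set
  Symbol = Γ M

  -- The clock shares the tape alphabet, so light and blank may coincide.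
  blank light heavy : Symbol
  blank = zero
  light = zero
  heavy = suc zero

  Tapes : Set
  Tapes = Vec (List Symbol × List Symbol) (suc N.nTapes-1)

  width : ℕ
  width = suc (suc (double (suc N.nTapes-1)))

  -- The first two stacks, A and B, serve as clock; then every tape has a stack for the cells to the
  -- left of the head, nearest on top, and one for the cells from the head on. While w is guessed,
  -- dbl₁ and dbl₂ move A to B writing every symbol twice, back₁ and back₂ move B back to A, and
  -- add i pushes light symbols on A, with i further steps to go.
  data State : Set where
    initial dbl₁ dbl₂ back₁ back₂ rew erase accept : State
    add : Fin 24 → State
    sim : Fin N.nStates → State

  finState : Finite State
  finState .elements = initial ∷ dbl₁ ∷ dbl₂ ∷ back₁ ∷ back₂ ∷ rew ∷ erase ∷ accept ∷
    (List.map add (allFin 24) ++ List.map sim (allFin N.nStates))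
  finState .complete initial = here refl
  finState .complete dbl₁    = there (here refl)
  finState .complete dbl₂    = there (there (here refl))
  finState .complete back₁   = there (there (there (here refl)))
  finState .complete back₂   = there (there (there (there (here refl))))
  finState .complete rew     = there (there (there (there (there (here refl)))))
  finState .complete erase   = there (there (there (there (there (there (here refl))))))
  finState .complete accept  = there (there (there (there (there (there (there (here refl)))))))
  finState .complete (add i) = ∈-++⁺ʳ (initial ∷ dbl₁ ∷ dbl₂ ∷ back₁ ∷ back₂ ∷ rew ∷ erase ∷ accept ∷ [])
    (∈-++⁺ˡ (∈-map⁺ add (∈-allFin i)))
  finState .complete (sim q) = ∈-++⁺ʳ (initial ∷ dbl₁ ∷ dbl₂ ∷ back₁ ∷ back₂ ∷ rew ∷ erase ∷ accept ∷ [])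
    (∈-++⁺ʳ (List.map add (allFin 24)) (∈-map⁺ sim (∈-allFin q)))

  finSymbol : Finite Symbol
  finSymbol .elements = allFin _
  finSymbol .complete = ∈-allFin

  tapeOp : Move → Symbol → Maybe Symbol × Maybe Symbol → Op Symbol × Op Symbol
  -- Beyond the bottom of a stack the tape is blank, so an exhausted left stack yields `blank` as
  -- the newly scanned symbol.
  tapeOp left  x (l , r) = pop , two (fromMaybe blank l) x
  tapeOp right x (l , r) = push x l , pop
  tapeOp stay  x (l , r) = nop l , one x

  Tops : Set
  Tops = Vec (Maybe Symbol) (double (suc N.nTapes-1))

  Ops : Set
  Ops = Vec (Op Symbol) (double (suc N.nTapes-1))

  scanned : Tops → Vec Symbol (suc N.nTapes-1)
  scanned v = tabulate λ i → fromMaybe blank (proj₂ (lookup (uninterleave _ v) i))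

  tapeOpPairs : Vec Symbol (suc N.nTapes-1) → Vec Move (suc N.nTapes-1) → Tops →
    Vec (Op Symbol × Op Symbol) (suc N.nTapes-1)
  tapeOpPairs ws ms v = tabulate λ i → tapeOp (lookup ms i) (lookup ws i) (lookup (uninterleave _ v) i)

  tapeOps : Vec Symbol (suc N.nTapes-1) → Vec Move (suc N.nTapes-1) → Tops → Ops
  tapeOps ws ms v = interleave (tapeOpPairs ws ms v)

  addOp : ℕ → Maybe Symbol → Op Symbol
  addOp zero    a = nop a
  addOp (suc _) a = push light a

  afterAdd : Fin 24 → List State
  -- Here it is guessed whether a further bit follows or w is complete.
  afterAdd zero    = dbl₁ ∷ rew ∷ []
  afterAdd (suc i) = add (inject₁ i) ∷ []

  afterDbl : Maybe Symbol → State
  afterDbl nothing  = back₁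
  afterDbl (just _) = dbl₁

  -- Four symbols are added in 6 · 4 = 24 steps, pushing in the first four of them. Of those for the
  -- first bit, the initial state accounts for two pushes and one step, and one more step is left to
  -- the transition into accept.
  add-first add-bit : Fin 24
  add-first = # 21
  add-bit   = # 23

  tick : Symbol → Maybe Symbol → State × Ops → State × Vec (Op Symbol) width
  tick s b (q , os) = q , pop ∷ push s b ∷ os

  simulateStep : Fin N.nStates → Symbol → Tops → List (State × Ops)
  simulateStep q (suc zero) v = List.map (λ (q′ , ws , ms) → sim q′ , tapeOps ws ms v) (N.δ q (scanned v))
  simulateStep q _          v = []

  work : State → Tops → Symbol → List (State × Ops)
  work rew     (just y ∷ r ∷ v)  s = (rew , pop ∷ push y r ∷ map nop v) ∷ []
  work rew     (nothing ∷ v)     s = (sim N.start , pop ∷ map nop v) ∷ []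
  -- Idling is possible on every clock symbol, so a shorter computation can wait until the clock has
  -- run down.
  work (sim q) v                 s = (sim q , map nop v) ∷ simulateStep q s v
  work _       _                 s = []

  step : State → Vec (Maybe Symbol) width → List (State × Vec (Op Symbol) width)
  step initial (a ∷ b ∷ l ∷ v)       =
    (add add-first , two heavy heavy ∷ nop b ∷ push (enc M true) l ∷ map nop v) ∷ []
  -- Counting the present step, `suc (toℕ i)` steps remain; pushing stops once at most 20 do.
  step (add i) (a ∷ v)               = List.map (λ q → q , addOp (suc (toℕ i) ∸ 20) a ∷ map nop v) (afterAdd i)
  step dbl₁    (just s ∷ b ∷ v)      = (dbl₂ , pop ∷ push s b ∷ map nop v) ∷ []
  step dbl₂    (a ∷ just s ∷ v)      = (afterDbl a , nop a ∷ two s s ∷ map nop v) ∷ []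
  step back₁   (a ∷ just s ∷ v)      = (back₂ , push s a ∷ pop ∷ map nop v) ∷ []
  -- A waiting step, so that moving a symbol back costs two steps. For the last symbol, the choice
  -- of the next bit takes its place.
  step back₂   (a ∷ just s ∷ v)      = (back₁ , nop a ∷ one s ∷ map nop v) ∷ []
  -- The next bit is a zero with more to follow, a final zero, or a one, for which that decision is
  -- postponed until the symbols have been added.
  step back₂   (a ∷ nothing ∷ l ∷ v) =
    (dbl₁ , nop a ∷ pop ∷ push (enc M false) l ∷ map nop v) ∷
    (rew , nop a ∷ pop ∷ push (enc M false) l ∷ map nop v) ∷
    (add add-bit , nop a ∷ pop ∷ push (enc M true) l ∷ map nop v) ∷ []
  step (sim q) (nothing ∷ just s ∷ v) =
    if N.final q then (erase , replicate _ pop) ∷ [] else []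
  step erase   (a ∷ just s ∷ v)      = (erase , replicate _ pop) ∷ []
  step erase   (a ∷ nothing ∷ v)     = (accept , replicate _ pop) ∷ []
  step rew     (just s ∷ b ∷ v)      = List.map (tick s b) (work rew v s)
  step (sim q) (just s ∷ b ∷ v)      = List.map (tick s b) (work (sim q) v s)
  step _       _                     = []

  isAccept : State → Bool
  isAccept accept = true
  isAccept _      = false

  machine : StackMachine
  machine = record
    { Q = State ; A = Symbol ; finQ = finState ; finA = finSymbol ; nStacks = width
    ; start = initial ; final = isAccept ; δ = step }
  open StackMachine machine using (Stacks; empty; tops; Reach; init; _▻_; AcceptsAt; AcceptsEmptyAt)

  -- The simulated tapes

  record Holds (f : ℤ → Symbol) (h : ℤ) (d : List Symbol × List Symbol) : Set where
    field
      toLeft  : ∀ j → at f h -[1+ j ] ≡ fromMaybe blank (nth (proj₁ d) j)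
      toRight : ∀ j → at f h (+ j) ≡ fromMaybe blank (nth (proj₂ d) j)
  open Holds

  updateTape : Op Symbol × Op Symbol → List Symbol × List Symbol → List Symbol × List Symbol
  updateTape (o , o′) (l , r) = update o l , update o′ r

  heads : List Symbol × List Symbol → Maybe Symbol × Maybe Symbol
  heads = Product.map List.head List.head

  holds-scanned : ∀ {f h d} → Holds f h d → fromMaybe blank (proj₂ (heads d)) ≡ f h
  holds-scanned {f} {h} {_ , r} H = trans (cong (fromMaybe blank) (sym (nth-head r)))
    (trans (sym (toRight H 0)) (cong f (ℤ.+-identityʳ h)))

  drop-toRight : ∀ {f h d} → Holds f h d → ∀ j → at f h (+ suc j) ≡ fromMaybe blank (nth (List.drop 1 (proj₂ d)) j)
  drop-toRight {d = _ , r} H j = trans (toRight H (suc j)) (cong (fromMaybe blank) (nth-suc r j))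

  holds-update : ∀ {f h d} x m → Holds f h d →
    Holds (write f h x) (shift m h) (updateTape (tapeOp m x (heads d)) d)
  holds-update {f} {h} {l , r} x left H .toLeft j =
    trans (move-at f h x left -[1+ j ]) (trans (toLeft H (suc j)) (cong (fromMaybe blank) (nth-suc l j)))
  holds-update {f} {h} {l , r} x left H .toRight zero =
    trans (move-at f h x left (+ 0)) (trans (toLeft H 0) (cong (fromMaybe blank) (nth-head l)))
  holds-update {f} {h} {l , r} x left H .toRight (suc zero)    = move-at f h x left (+ 1)
  holds-update {f} {h} {l , r} x left H .toRight (suc (suc j)) =
    trans (move-at f h x left (+ suc (suc j))) (drop-toRight H j)
  holds-update {f} {h} {l , r} x right H .toLeft zero    rewrite update-push x l = move-at f h x right -[1+ 0 ]
  holds-update {f} {h} {l , r} x right H .toLeft (suc j) rewrite update-push x l =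
    trans (move-at f h x right -[1+ suc j ]) (toLeft H j)
  holds-update {f} {h} {l , r} x right H .toRight j = trans (move-at f h x right (+ j)) (drop-toRight H j)
  holds-update {f} {h} {l , r} x stay H .toLeft j rewrite update-nop l =
    trans (move-at f h x stay -[1+ j ]) (toLeft H j)
  holds-update {f} {h} {l , r} x stay H .toRight zero    = move-at f h x stay (+ 0)
  holds-update {f} {h} {l , r} x stay H .toRight (suc j) = trans (move-at f h x stay (+ suc j)) (drop-toRight H j)

  HoldsAll : NConfig M → Tapes → Set
  HoldsAll c ds = ∀ i → Holds (tape c i) (head c i) (lookup ds i)

  topsOf : Tapes → Tops
  topsOf ds = map List.head (interleave ds)

  scanned-correct : ∀ c ds → HoldsAll c ds → scanned (topsOf ds) ≡ readSyms c
  scanned-correct c ds H = tabulate-cong λ i →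
    trans (cong (fromMaybe blank ∘ proj₂) (lookup-uninterleave-map List.head ds i)) (holds-scanned (H i))

  stepTapes : Vec Symbol (suc N.nTapes-1) → Vec Move (suc N.nTapes-1) → Tapes → Tapes
  stepTapes ws ms ds = zipWith updateTape (tapeOpPairs ws ms (topsOf ds)) ds

  update-tapeOps : ∀ ws ms ds → zipWith update (tapeOps ws ms (topsOf ds)) (interleave ds) ≡ interleave (stepTapes ws ms ds)
  update-tapeOps ws ms ds = zipWith-interleave update (tapeOpPairs ws ms (topsOf ds)) ds

  holdsAll-apply : ∀ c ds q ws ms → HoldsAll c ds → HoldsAll (apply c (q , ws , ms)) (stepTapes ws ms ds)
  holdsAll-apply c ds q ws ms H i =
    subst (Holds _ _) (sym (trans (lookup-zipWith updateTape i (tapeOpPairs ws ms (topsOf ds)) ds)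
        (cong (λ o → updateTape o (lookup ds i))
          (trans (lookup∘tabulate (λ i → tapeOp (lookup ms i) (lookup ws i) (lookup (uninterleave _ (topsOf ds)) i)) i)
            (cong (tapeOp (lookup ms i) (lookup ws i)) (lookup-uninterleave-map List.head ds i))))))
      (holds-update (lookup ws i) (lookup ms i) (H i))

  code : List Bool → List Symbol
  code = List.map (enc M)

  inputTapes : List Bool → Tapes
  inputTapes w = ([] , code w) ∷ replicate _ ([] , [])

  holdsAll-initN : ∀ w → HoldsAll (initN M w) (inputTapes w)
  holdsAll-initN w zero .toLeft j = refl
  holdsAll-initN w zero .toRight j = input w j
    where
      input : ∀ w j → nthSym M w j ≡ fromMaybe blank (nth (code w) j)
      input []      j       = refl
      input (b ∷ w) zero    = refl
      input (b ∷ w) (suc j) = input w j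
  holdsAll-initN w (suc i) = subst (Holds _ _) (sym (lookup-replicate i ([] , [])))
    record { toLeft = λ _ → refl ; toRight = λ _ → refl }

  steps-snoc : ∀ {n c c′ c″} → NSteps M n c c′ → NStep M c′ c″ → NSteps M (suc n) c c″
  steps-snoc done        s = next s done
  steps-snoc (next s ss) s′ = next s (steps-snoc ss s′)

  -- The invariant of all runs

  clock : List Bool → List Symbol
  clock []          = light ∷ light ∷ heavy ∷ heavy ∷ []
  clock (false ∷ r) = twice (clock r)
  clock (true ∷ r)  = pushes 4 light (twice (clock r))

  length-clock : ∀ r → length (clock r) ≡ value r * 4
  length-clock []      = refl
  length-clock (b ∷ r) = go b
    where
      swap : ∀ n → n * 4 * 2 ≡ n * 2 * 4
      swap = solve-∀

      doubled : length (twice (clock r)) ≡ value r * 2 * 4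
      doubled = trans (length-twice (clock r)) (trans (cong (_* 2) (length-clock r)) (swap (value r)))

      go : ∀ b → length (clock (b ∷ r)) ≡ value (b ∷ r) * 4
      go false = doubled
      go true  = cong (λ n → 4 + n) doubled

  weight : Symbol → ℕ
  weight zero          = 0
  weight (suc zero)    = 1
  weight (suc (suc _)) = 0

  weights : List Symbol → ℕ
  weights []      = 0
  weights (s ∷ A) = weight s + weights A

  weights-twice : ∀ A → weights (twice A) ≡ 2 * weights A
  weights-twice []      = refl
  weights-twice (s ∷ A) = trans (cong (λ n → weight s + (weight s + n)) (weights-twice A)) (regroup (weight s) (weights A))
    where
      regroup : ∀ m n → m + (m + 2 * n) ≡ 2 * (m + n)
      regroup = solve-∀

  weights-clock : ∀ r → weights (clock r) ≡ 2 ^ suc (length r)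
  weights-clock []          = refl
  weights-clock (false ∷ r) = trans (weights-twice (clock r)) (cong (2 *_) (weights-clock r))
  weights-clock (true ∷ r)  = trans (weights-twice (clock r)) (cong (2 *_) (weights-clock r))

  -- The guessed bits lie on the left stack of the first tape with the leading one at the bottom, so
  -- moving them onto the right stack turns them round into `wordOf r`.
  generated : List Symbol → List Symbol → List Bool → Stacks
  generated A B r = A ∷ B ∷ code (r ++ true ∷ []) ∷ replicate _ []

  record Ticking (t : ℕ) (A B : List Symbol) (r : List Bool) : Set where
    constructor ticking
    field
      total : length A + length B ≡ length (clock r)
      -- The time is one short of six steps per clock symbol plus the symbols used; the missing step
      -- is the one into `accept`.
      time  : suc t ≡ 6 * length (clock r) + length B

  ticking-suc : ∀ {t s A B r} → Ticking t (s ∷ A) B r → Ticking (suc t) A (s ∷ B) r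
  ticking-suc {A = A} {B} (ticking total time) =
    ticking (trans (ℕ.+-suc (length A) (length B)) total) (trans (cong suc time) (sym (ℕ.+-suc _ (length B))))

  AcceptsInTime : List Bool → Set
  AcceptsInTime r = AcceptsWithin M (wordOf r) (2 ^ length (wordOf r))

  -- With x the length of `clock r`, the clauses fix the time exactly: the clock is complete at time
  -- 6x - 1, doubling takes 2x steps and moving back 4x, so 12x - 1 is the same figure for the
  -- doubled clock. In `at-sim`, the steps simulated and the heavy symbols left together stay within
  -- the time bound.
  data Invariant (t : ℕ) : State → Stacks → Set where
    at-initial : t ≡ 0 → Invariant t initial empty
    at-add : ∀ {i A} r → pushes (suc (toℕ i) ∸ 20) light A ≡ clock r →
      suc t + suc (toℕ i) ≡ 6 * length (clock r) → Invariant t (add i) (generated A [] r)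
    at-dbl₁ : ∀ {A} r ys → ys ʳ++ A ≡ clock r →
      suc t ≡ 6 * length (clock r) + 2 * length ys → Invariant t dbl₁ (generated A (twice ys) r)
    at-dbl₂ : ∀ {A} r s ys → ys ʳ++ s ∷ A ≡ clock r →
      t ≡ 6 * length (clock r) + 2 * length ys → Invariant t dbl₂ (generated A (s ∷ twice ys) r)
    at-back₁ : ∀ {A B} r → B ʳ++ A ≡ twice (clock r) →
      suc t ≡ 8 * length (clock r) + 2 * length A → Invariant t back₁ (generated A B r)
    at-back₂ : ∀ {A B} r → B ʳ++ A ≡ twice (clock r) →
      suc (suc t) ≡ 8 * length (clock r) + 2 * length A → Invariant t back₂ (generated A B r)
    at-rew : ∀ {A B} r l w → Ticking t A B r → weights A ≤ 2 ^ suc (length r) →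
      l ʳ++ w ≡ wordOf r → Invariant t rew (A ∷ B ∷ code l ∷ code w ∷ replicate _ [])
    at-sim : ∀ {A B} r n c ds → Ticking t A B r → n + weights A ≤ 2 ^ suc (length r) →
      NSteps M n (initN M (wordOf r)) c → HoldsAll c ds → Invariant t (sim (state c)) (A ∷ B ∷ interleave ds)
    at-erase : ∀ {A B v} r → AcceptsInTime r → suc t + length B ≡ 8 * length (clock r) → Invariant t erase (A ∷ B ∷ v)
    at-accept : ∀ {s} r → AcceptsInTime r → t ≡ 8 * length (clock r) → Invariant t accept s

  update-empty : ∀ {n} → zipWith update (map nop (map List.head (replicate n []))) (replicate n []) ≡
    replicate {A = List Symbol} n []
  update-empty = update-nops (replicate _ [])

  twice-reverse : ∀ ys r → ys ʳ++ [] ≡ clock r → twice ys ʳ++ [] ≡ twice (clock r)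
  twice-reverse ys r eq = trans (twice-ʳ++ ys) (cong twice eq)

  rewind-start : ∀ r → (r ++ true ∷ []) ʳ++ [] ≡ wordOf r
  rewind-start r = reverse-++ r (true ∷ [])

  update-addOp : ∀ n A → pushes n light A ≡ pushes (pred n) light (update (addOp n (List.head A)) A)
  update-addOp zero    A = sym (update-nop A)
  update-addOp (suc n) A = cong (pushes n light) (sym (update-push light A))

  -- One push is performed now and one fewer remains; when none is due, truncated subtraction keeps
  -- the count at zero and `addOp` leaves the stack alone.
  pushes-next : ∀ (i : Fin 23) A → let n = suc (suc (toℕ i)) ∸ 20 in
    pushes (suc (toℕ (inject₁ i)) ∸ 20) light (update (addOp n (List.head A)) A) ≡ pushes n light A
  pushes-next i A =
    trans (cong (λ k → pushes k light A′)
      (trans (cong (λ k → suc k ∸ 20) (toℕ-inject₁ i)) (sym (ℕ.pred[m∸n]≡m∸[1+n] (suc (suc (toℕ i))) 20))))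
    (sym (update-addOp (suc (suc (toℕ i)) ∸ 20) A))
    where
      A′ : List Symbol
      A′ = update (addOp (suc (suc (toℕ i)) ∸ 20) (List.head A)) A

  ready : ∀ {t} r {q} → q ∈ dbl₁ ∷ rew ∷ [] → suc t ≡ 6 * length (clock r) → Invariant t q (generated (clock r) [] r)
  ready {t} r (here refl)         eq = at-dbl₁ r [] refl (trans eq (sym (ℕ.+-identityʳ _)))
  ready {t} r (there (here refl)) eq =
    at-rew r (r ++ true ∷ []) [] (ticking (ℕ.+-identityʳ _) (trans eq (sym (ℕ.+-identityʳ _))))
      (ℕ.≤-reflexive (weights-clock r)) (rewind-start r)

  twelve : ∀ r {t} → suc (suc t) ≡ 8 * length (clock r) + 2 * length (twice (clock r)) →
    suc (suc t) ≡ 6 * length (twice (clock r))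
  twelve r eq = trans eq (trans (cong (λ n → 8 * length (clock r) + 2 * n) (length-twice (clock r)))
    (trans (regroup (length (clock r))) (cong (6 *_) (sym (length-twice (clock r))))))
    where
      regroup : ∀ n → 8 * n + 2 * (n * 2) ≡ 6 * (n * 2)
      regroup = solve-∀

  two-more : ∀ a y → suc (suc (a + 2 * y)) ≡ a + 2 * suc y
  two-more = solve-∀

  update-bit : ∀ b A r →
    zipWith update
      (nop (List.head A) ∷ pop ∷ push (enc M b) (List.head (code (r ++ true ∷ []))) ∷
        map nop (map List.head (replicate _ [])))
      (generated A [] r) ≡ generated A [] (b ∷ r)
  update-bit b A r rewrite update-nop A | update-push (enc M b) (code (r ++ true ∷ []))
    | update-nops (replicate {A = List Symbol} (suc (double N.nTapes-1)) []) = refl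

  invariant-step : ∀ {t q s a} → Invariant t q s → a ∈ step q (tops s) →
    Invariant (suc t) (proj₁ a) (zipWith update (proj₂ a) s)
  invariant-step (at-initial refl) (here refl) =
    subst (Invariant 1 (add add-first))
      (cong (λ v → (heavy ∷ heavy ∷ []) ∷ [] ∷ code (true ∷ []) ∷ v) (sym update-empty))
      -- Two light pushes are due, and 2 + 22 = 6 · 4.
      (at-add [] refl refl)
  invariant-step {t} (at-add {i} {A} r eq time) a∈ with ∈-map⁻ _ a∈
  ... | q , q∈ , refl =
    subst (Invariant _ q) (cong (update (addOp (suc (toℕ i) ∸ 20) (List.head A)) A ∷_) (sym (update-nops _)))
      (next-add i q∈ eq time)
    where
      next-add : ∀ i → q ∈ afterAdd i → pushes (suc (toℕ i) ∸ 20) light A ≡ clock r →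
        suc t + suc (toℕ i) ≡ 6 * length (clock r) →
        Invariant (suc t) q (generated (update (addOp (suc (toℕ i) ∸ 20) (List.head A)) A) [] r)
      next-add zero q∈ eq time =
        subst (λ A → Invariant (suc t) q (generated A [] r)) (trans (sym eq) (sym (update-nop A)))
          (ready r q∈ (trans (ℕ.+-comm 1 (suc t)) time))
      next-add (suc i) (here refl) eq time =
        at-add r (trans (pushes-next i A) eq)
          (trans (cong (λ n → suc (suc t) + suc n) (toℕ-inject₁ i)) (trans (sym (ℕ.+-suc (suc t) (suc (toℕ i)))) time))
  invariant-step (at-dbl₁ {s ∷ A} r ys eq time) (here refl) =
    subst (Invariant _ dbl₂) (cong₂ (λ b v → A ∷ b ∷ v) (sym (update-push s (twice ys))) (sym (update-nops _)))
      (at-dbl₂ r s ys eq time)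
  invariant-step (at-dbl₂ {[]} r s ys eq time) (here refl) =
    subst (Invariant _ back₁) (cong (λ v → [] ∷ (s ∷ s ∷ twice ys) ∷ v) (sym (update-nops _)))
      (at-back₁ r (twice-reverse (s ∷ ys) r eq) (finished time (trans (cong length (sym eq)) (length-reverse (s ∷ ys)))))
    where
      regroup : ∀ y → suc (suc (6 * suc y + 2 * y)) ≡ 8 * suc y + 0
      regroup = solve-∀

      finished : ∀ {t x y} → t ≡ 6 * x + 2 * y → x ≡ suc y → suc (suc t) ≡ 8 * x + 0
      finished {y = y} refl refl = regroup y
  invariant-step (at-dbl₂ {x ∷ A} r s ys eq time) (here refl) =
    subst (Invariant _ dbl₁) (cong (λ v → (x ∷ A) ∷ (s ∷ s ∷ twice ys) ∷ v) (sym (update-nops _)))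
      (at-dbl₁ r (s ∷ ys) eq (trans (cong (λ n → suc (suc n)) time) (two-more _ (length ys))))
  invariant-step (at-back₁ {A} {s ∷ B} r eq time) (here refl) =
    subst (Invariant _ back₂) (cong₂ (λ a v → a ∷ B ∷ v) (sym (update-push s A)) (sym (update-nops _)))
      (at-back₂ r eq (trans (cong (λ n → suc (suc n)) time) (two-more _ (length A))))
  invariant-step (at-back₂ {A} {s ∷ B} r eq time) (here refl) =
    subst (Invariant _ back₁) (cong₂ (λ a v → a ∷ (s ∷ B) ∷ v) (sym (update-nop A)) (sym (update-nops _)))
      (at-back₁ r eq time)
  invariant-step (at-back₂ {A} {[]} r refl time) (here refl) =
    subst (Invariant _ _) (sym (update-bit false A r)) (ready (false ∷ r) (here refl) (twelve r time))
  invariant-step (at-back₂ {A} {[]} r refl time) (there (here refl)) =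
    subst (Invariant _ _) (sym (update-bit false A r)) (ready (false ∷ r) (there (here refl)) (twelve r time))
  invariant-step {t} (at-back₂ {A} {[]} r refl time) (there (there (here refl))) =
    subst (Invariant _ _) (sym (update-bit true A r))
      (at-add (true ∷ r) refl (trans (cong (_+ 24) (twelve r time)) (regroup (length A))))
    where
      regroup : ∀ n → 6 * n + 24 ≡ 6 * (4 + n)
      regroup = solve-∀
  -- An empty left stack forces the right one to hold all of `wordOf r`, so the tapes are those of
  -- the initial configuration of `M`.
  invariant-step (at-rew {s ∷ A} {B} r [] w tk le refl) (here refl) =
    subst (Invariant _ (sim N.start))
      (cong₂ (λ b v → A ∷ b ∷ [] ∷ v) (sym (update-push s B))
        (trans (cong (code w ∷_) (interleave-replicate N.nTapes-1 [])) (sym (update-nops _))))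
      (at-sim r 0 (initN M w) (inputTapes w) (ticking-suc tk) (ℕ.≤-trans (ℕ.m≤n+m _ (weight s)) le) done (holdsAll-initN w))
  invariant-step (at-rew {s ∷ A} {B} r (y ∷ l) w tk le eq) (here refl) =
    subst (Invariant _ rew)
      (cong₂ (λ b v → A ∷ b ∷ code l ∷ v) (sym (update-push s B))
        (cong₂ _∷_ (sym (update-push (enc M y) (code w))) (sym (update-nops _))))
      (at-rew r l (y ∷ w) (ticking-suc tk) (ℕ.≤-trans (ℕ.m≤n+m _ (weight s)) le) eq)
  invariant-step (at-sim {s ∷ A} {B} r n c ds tk le run holds) (here refl) =
    subst (Invariant _ (sim (state c))) (cong₂ (λ b v → A ∷ b ∷ v) (sym (update-push s B)) (sym (update-nops _)))
      (at-sim r n c ds (ticking-suc tk) (ℕ.≤-trans (ℕ.+-monoʳ-≤ n (ℕ.m≤n+m _ (weight s))) le) run holds)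
  -- For other symbols `simulateStep` is empty. Here the weight 1 of the symbol used up pays for the
  -- increment of n.
  invariant-step (at-sim {suc zero ∷ A} {B} r n c ds tk le run holds) (there a∈) with ∈-map⁻ _ a∈
  ... | a , a∈′ , refl with ∈-map⁻ _ a∈′
  ... | (q , ws , ms) , t∈ , refl =
    subst (Invariant _ (sim q)) (cong₂ (λ b v → A ∷ b ∷ v) (sym (update-push heavy B)) (sym (update-tapeOps ws ms ds)))
      (at-sim r (suc n) (apply c (q , ws , ms)) (stepTapes ws ms ds) (ticking-suc tk)
        (ℕ.≤-trans (ℕ.≤-reflexive (sym (ℕ.+-suc n (weights A)))) le)
        (steps-snoc run (nstep (subst (λ v → (q , ws , ms) ∈ N.δ (state c) v) (scanned-correct c ds holds) t∈)))
        (holdsAll-apply c ds q ws ms holds))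
  invariant-step (at-sim {[]} {s ∷ B} r n c ds tk le run holds) a∈ with N.final (state c) in fin
  invariant-step {t} (at-sim {[]} {s ∷ B} r n c ds (ticking total time) le run holds) (here refl) | true =
    -- The clock is empty, so the bound on `n + weights A` has become the time bound on n itself.
    at-erase r
      (n , c ,
        ℕ.≤-trans (ℕ.m≤m+n n 0) (ℕ.≤-trans le (ℕ.≤-reflexive (cong (λ k → 2 ^ suc k) (sym (length-reverse r))))) ,
        run , fin)
      (finished time total)
    where
      regroup : ∀ b → suc (6 * suc b + suc b) + b ≡ 8 * suc b
      regroup = solve-∀

      finished : ∀ {t x b} → suc t ≡ 6 * x + suc b → suc b ≡ x → suc (suc t) + b ≡ 8 * x
      finished {b = b} time refl = trans (cong (λ n → suc n + b) time) (regroup b)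
  invariant-step (at-erase {B = s ∷ B} r acc time) (here refl) = at-erase r acc (trans (sym (ℕ.+-suc (suc _) (length B))) time)
  invariant-step (at-erase {B = []} r acc time) (here refl) = at-accept r acc (trans (sym (ℕ.+-identityʳ (suc _))) time)

  invariant : ∀ {t q s} → Reach t q s → Invariant t q s
  invariant init     = at-initial refl
  invariant (r ▻ a∈) = invariant-step (invariant r) a∈

  machine-sound : ∀ {t} → AcceptsAt t → ∃ λ r → AcceptsInTime r × t ≡ value r * 2 ^ 5
  machine-sound (accept , s , run , refl) with invariant run
  ... | at-accept r acc time = r , acc , trans time (trans (cong (8 *_) (length-clock r)) (regroup (value r)))
    where
      regroup : ∀ n → 8 * (n * 4) ≡ n * 32
      regroup = solve-∀

  -- The accepting runs

  Reachable : State → Stacks → Set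
  Reachable q s = ∃ λ t → Reach t q s

  go : ∀ {q s q′ s′ os} → Reachable q s → (q′ , os) ∈ step q (tops s) →
    zipWith update os s ≡ s′ → Reachable q′ s′
  go (t , r) a∈ refl = suc t , r ▻ a∈

  Rest : Set
  Rest = Vec (List Symbol) (double (suc N.nTapes-1))

  -- Both ends are in `back₂`, since the next bit is chosen there, in place of the waiting step of
  -- the last symbol.
  copy-back : ∀ B A (v : Rest) → Reachable back₂ (A ∷ B ∷ v) → Reachable back₂ ((B ʳ++ A) ∷ [] ∷ v)
  copy-back []      A v reach = reach
  copy-back (s ∷ B) A v reach = copy-back B (s ∷ A) v
    (go (go reach (here refl) (cong₂ (λ a v → a ∷ (s ∷ B) ∷ v) (update-nop A) (update-nops v)))
      (here refl) (cong₂ (λ a v → a ∷ B ∷ v) (update-push s A) (update-nops v)))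

  double-clock : ∀ A s ys (v : Rest) → Reachable dbl₁ ((s ∷ A) ∷ twice ys ∷ v) →
    Reachable back₂ ((twice (A ʳ++ s ∷ ys) ʳ++ []) ∷ [] ∷ v)
  double-clock A s ys v reach = next-symbol A
    (go reach (here refl) (cong₂ (λ b v → A ∷ b ∷ v) (update-push s (twice ys)) (update-nops v)))
    where
      next-symbol : ∀ A → Reachable dbl₂ (A ∷ (s ∷ twice ys) ∷ v) →
        Reachable back₂ ((twice (A ʳ++ s ∷ ys) ʳ++ []) ∷ [] ∷ v)
      next-symbol [] reach = copy-back (s ∷ twice ys) (s ∷ []) v
        (go (go reach (here refl) (cong (λ v → [] ∷ (s ∷ s ∷ twice ys) ∷ v) (update-nops v)))
          (here refl) (cong (λ v → (s ∷ []) ∷ (s ∷ twice ys) ∷ v) (update-nops v)))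
      next-symbol (x ∷ A) reach = double-clock A x (s ∷ ys) v
        (go reach (here refl) (cong (λ v → (x ∷ A) ∷ (s ∷ s ∷ twice ys) ∷ v) (update-nops v)))

  double-nonempty : ∀ A (v : Rest) → 1 ≤ length A → Reachable dbl₁ (A ∷ [] ∷ v) → Reachable back₂ (twice A ∷ [] ∷ v)
  double-nonempty (s ∷ A) v _ reach = subst (λ B → Reachable back₂ (B ∷ [] ∷ v))
    (trans (twice-ʳ++ (A ʳ++ s ∷ [])) (cong twice (reverse-involutive (s ∷ A)))) (double-clock A s [] v reach)

  -- `inject₁ i` is not structurally smaller than `suc i`, so the recursion runs on n.
  add-lights : ∀ n {q} i A r → toℕ i ≡ n → pushes (suc (toℕ i) ∸ 20) light A ≡ clock r → q ∈ dbl₁ ∷ rew ∷ [] →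
    Reachable (add i) (generated A [] r) → Reachable q (generated (clock r) [] r)
  add-lights n zero A r _ eq (here refl) reach =
    go reach (here refl) (cong₂ _∷_ (trans (update-nop A) eq) (update-nops _))
  add-lights n zero A r _ eq (there (here refl)) reach =
    go reach (there (here refl)) (cong₂ _∷_ (trans (update-nop A) eq) (update-nops _))
  add-lights (suc n) (suc i) A r i≡n eq q∈ reach =
    add-lights n (inject₁ i) A′ r (trans (toℕ-inject₁ i) (ℕ.suc-injective i≡n)) (trans (pushes-next i A) eq) q∈
      (go reach (here refl) (cong (A′ ∷_) (update-nops _)))
    where
      A′ : List Symbol
      A′ = update (addOp (suc (suc (toℕ i)) ∸ 20) (List.head A)) A

  value-positive : ∀ r → 1 ≤ value r
  value-positive []          = s≤s z≤n
  value-positive (true ∷ r)  = s≤s z≤n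
  value-positive (false ∷ r) = ℕ.≤-trans (value-positive r) (ℕ.m≤m*n (value r) 2)

  clock-nonempty : ∀ r → 1 ≤ length (clock r)
  clock-nonempty r = ℕ.≤-trans (value-positive r)
    (ℕ.≤-trans (ℕ.m≤m*n (value r) 4) (ℕ.≤-reflexive (sym (length-clock r))))

  generate : ∀ r {q} → q ∈ dbl₁ ∷ rew ∷ [] → Reachable q (generated (clock r) [] r)
  generate [] q∈ = add-lights 21 add-first (heavy ∷ heavy ∷ []) [] refl refl q∈
    (go (0 , init) (here refl) (cong (λ v → (heavy ∷ heavy ∷ []) ∷ [] ∷ code (true ∷ []) ∷ v) update-empty))
  generate (b ∷ r) q∈ = append b q∈ (double-nonempty (clock r) _ (clock-nonempty r) (generate r (here refl)))
    where
      append : ∀ b {q} → q ∈ dbl₁ ∷ rew ∷ [] → Reachable back₂ (generated (twice (clock r)) [] r) →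
        Reachable q (generated (clock (b ∷ r)) [] (b ∷ r))
      append false (here refl)         reach = go reach (here refl) (update-bit false (twice (clock r)) r)
      append false (there (here refl)) reach = go reach (there (here refl)) (update-bit false (twice (clock r)) r)
      append true  q∈                  reach = add-lights 23 add-bit (twice (clock r)) (true ∷ r) refl refl q∈
        (go reach (there (there (here refl))) (update-bit true (twice (clock r)) r))

  -- Runs that use up the clock

  record Working (x : ℕ) (q : State) (A : List Symbol) (v : Rest) : Set where
    constructor working
    field
      {elapsed} : List Symbol
      total     : length A + length elapsed ≡ x
      reached   : Reachable q (A ∷ elapsed ∷ v)

  -- `step` reduces to `work` only for a known state, so the equation is a hypothesis; it holds by
  -- `refl` for `rew` and `sim`.
  work-step : ∀ {x q q′ s A v v′ os} → (∀ b u → step q (just s ∷ b ∷ u) ≡ List.map (tick s b) (work q u s)) →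
    Working x q (s ∷ A) v → (q′ , os) ∈ work q (map List.head v) s → zipWith update os v ≡ v′ → Working x q′ A v′
  work-step {s = s} {A} eq (working {B} total reach) a∈ refl =
    working (trans (ℕ.+-suc (length A) (length B)) total)
      (go reach (subst (_ ∈_) (sym (eq _ _)) (∈-map⁺ (tick s (List.head B)) a∈))
        (cong (λ b → A ∷ b ∷ _) (update-push s B)))

  rewind : ∀ l w {x A} (v : Vec _ _) → Working x rew (List.replicate (length l) light ++ A) (code l ∷ code w ∷ v) →
    Working x rew A ([] ∷ code (l ʳ++ w) ∷ v)
  rewind []      w v W = W
  rewind (y ∷ l) w v W = rewind l (y ∷ w) v (work-step (λ _ _ → refl) W (here refl)
    (cong₂ (λ r v → code l ∷ r ∷ v) (update-push (enc M y) (code w)) (update-nops v)))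

  idle : ∀ A {A′ x q v} → Working x (sim q) (A ++ A′) v → Working x (sim q) A′ v
  idle []      W = W
  idle (s ∷ A) {v = v} W = idle A (work-step (λ _ _ → refl) W (here refl) (update-nops v))

  Bounded : ℕ → ∀ {n} → Vec (List Symbol) n → Set
  Bounded n = All (λ s → length s ≤ n)

  bounded-update : ∀ {m n} (os : Vec (Op Symbol) m) v → Bounded (suc n) v → Bounded (suc (suc n)) (zipWith update os v)
  bounded-update []       []      []       = []
  bounded-update (o ∷ os) (s ∷ v) (p ∷ ps) = update-length o s p ∷ bounded-update os v ps

  -- Each step lengthens a stack by at most one; the resulting bound later shows that the erasing
  -- time suffices.
  simulate : ∀ {n c c′ x k A} ds → NSteps M n c c′ → HoldsAll c ds → Bounded (suc k) (interleave ds) →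
    Working x (sim (state c)) (List.replicate n heavy ++ A) (interleave ds) →
    ∃ λ v → Bounded (suc (n + k)) v × Working x (sim (state c′)) A v
  simulate ds done H bd W = _ , bd , W
  simulate {suc n} {c} {k = k} ds (next (nstep {t = q , ws , ms} t∈) run) H bd W
    with simulate (stepTapes ws ms ds) run (holdsAll-apply c ds q ws ms H)
           (subst (Bounded _) (update-tapeOps ws ms ds) (bounded-update (tapeOps ws ms (topsOf ds)) (interleave ds) bd))
           (work-step (λ _ _ → refl) W
             (there (∈-map⁺ _ (subst (λ v → (q , ws , ms) ∈ N.δ (state c) v) (sym (scanned-correct c ds H)) t∈)))
             (update-tapeOps ws ms ds))
  ... | v , bd′ , W′ = v , subst (λ m → Bounded (suc m) v) (ℕ.+-suc n k) bd′ , W′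

  pops : ∀ {n} → Vec (List Symbol) n → Vec (List Symbol) n
  pops = zipWith update (replicate _ pop)

  bounded-pops : ∀ {m n} (v : Vec _ m) → Bounded (suc n) v → Bounded n (pops v)
  bounded-pops []            []           = []
  bounded-pops ([] ∷ v)      (_ ∷ ps)     = z≤n ∷ bounded-pops v ps
  bounded-pops ((_ ∷ _) ∷ v) (s≤s p ∷ ps) = p ∷ bounded-pops v ps

  pops-empty : ∀ {n} (v : Vec _ n) → Bounded 0 v → pops v ≡ replicate n []
  pops-empty []       []       = refl
  pops-empty ([] ∷ v) (_ ∷ ps) = cong ([] ∷_) (pops-empty v ps)

  -- Every erasing step pops all stacks, so stacks no higher than the second clock stack are empty
  -- when it is.
  erase-all : ∀ B v {t} → Bounded (length B) v → Reach t erase ([] ∷ B ∷ v) → Reach (suc (length B + t)) accept empty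
  erase-all []      v     bd reach = subst (λ v → Reach _ accept ([] ∷ [] ∷ v)) (pops-empty v bd) (reach ▻ here refl)
  erase-all (s ∷ B) v {t} bd reach = subst (λ n → Reach (suc n) accept empty) (ℕ.+-suc (length B) t)
    (erase-all B (pops v) (bounded-pops v bd) (reach ▻ here refl))

  -- The invariant also tells the time of the accepting runs, so they are built without counting steps.
  sim-time : ∀ {t q s A B v} → Invariant t (sim q) s → s ≡ A ∷ B ∷ v → suc t ≡ 6 * (length A + length B) + length B
  sim-time {B = B} (at-sim r n c ds (ticking total time) _ _ _) refl = trans time (cong (λ x → 6 * x + length B) (sym total))

  -- The step into `erase` needs a symbol on the second stack, which `1 ≤ x` provides. It pops the
  -- other stacks as well, so their heights may reach x.
  finish : ∀ {x q v} → N.final q ≡ true → 1 ≤ x → Bounded x v → Working x (sim q) [] v → AcceptsEmptyAt (8 * x)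
  finish {q = q} {v} fin _ bd (working {s ∷ B} refl (t , reach)) =
    accept , subst (λ n → Reach n accept empty) arith (erase-all B (pops v) (bounded-pops v bd) (reach ▻ final∈)) , refl
    where
      final∈ : (erase , replicate width pop) ∈ step (sim q) (nothing ∷ just s ∷ map List.head v)
      final∈ rewrite fin = here refl

      regroup : ∀ b → suc (b + (6 * suc b + suc b)) ≡ 8 * suc b
      regroup = solve-∀

      arith : suc (length B + suc t) ≡ 8 * suc (length B)
      arith = trans (cong (λ n → suc (length B + n)) (sim-time (invariant reach) refl)) (regroup (length B))
  finish _ () _ (working {[]} refl _)

  twice-replicate : ∀ n x (s : List Symbol) → twice (List.replicate n x ++ s) ≡ List.replicate (n * 2) x ++ twice s
  twice-replicate zero    x s = refl
  twice-replicate (suc n) x s = cong (λ s → x ∷ x ∷ s) (twice-replicate n x s)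

  replicate-+ : ∀ m n (x : Symbol) → List.replicate (m + n) x ≡ List.replicate m x ++ List.replicate n x
  replicate-+ zero    n x = refl
  replicate-+ (suc m) n x = cong (x ∷_) (replicate-+ m n x)

  -- Doubling multiplies both numbers by two, and a one adds only light symbols, on top. So the
  -- light symbols are at least as many as the heavy ones, enough for rewinding.
  clock-shape : ∀ r → let p = 2 ^ suc (length r) in
    ∃ λ n → p ≤ n × clock r ≡ List.replicate n light ++ List.replicate p heavy
  clock-shape [] = 2 , ℕ.≤-refl , refl
  clock-shape (b ∷ r) with clock-shape r
  ... | n , p≤n , eq = shape b
    where
      p : ℕ
      p = 2 ^ suc (length r)

      doubled : twice (clock r) ≡ List.replicate (n * 2) light ++ List.replicate (2 * p) heavy
      doubled = trans (cong twice eq) (trans (twice-replicate n light _) (cong (List.replicate (n * 2) light ++_)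
        (trans (cong twice (sym (++-identityʳ (List.replicate p heavy))))
        (trans (twice-replicate p heavy []) (trans (++-identityʳ _) (cong (λ k → List.replicate k heavy) (ℕ.*-comm p 2)))))))

      le : 2 * p ≤ n * 2
      le = ℕ.≤-trans (ℕ.≤-reflexive (ℕ.*-comm 2 p)) (ℕ.*-monoˡ-≤ 2 p≤n)

      shape : ∀ b → ∃ λ n → 2 * p ≤ n × clock (b ∷ r) ≡ List.replicate n light ++ List.replicate (2 * p) heavy
      shape false = n * 2 , le , doubled
      shape true  = 4 + n * 2 , ℕ.≤-trans le (ℕ.m≤n+m (n * 2) 4) , cong (pushes 4 light) doubled

  n<2^n : ∀ n → suc n ≤ 2 ^ n
  n<2^n zero    = s≤s z≤n
  n<2^n (suc n) = ℕ.≤-trans (s≤s (n<2^n n)) (ℕ.+-mono-≤ (ℕ.m^n>0 2 n) (ℕ.m≤m+n (2 ^ n) 0))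

  bounded-empty : ∀ {k} n → Bounded k (interleave (replicate n ([] , [])))
  bounded-empty zero    = []
  bounded-empty (suc n) = z≤n ∷ z≤n ∷ bounded-empty n

  machine-complete : ∀ r → AcceptsInTime r → AcceptsEmptyAt (value r * 2 ^ 5)
  machine-complete r (n , c , n≤ , run , fin) with clock-shape r
  ... | lights , p≤lights , shape = subst AcceptsEmptyAt time (finish fin (clock-nonempty r) bounded idled)
    where
      p x : ℕ
      p = 2 ^ suc (length r)
      x = length (clock r)

      word : List Bool
      word = r ++ true ∷ []

      n≤p : n ≤ p
      n≤p = ℕ.≤-trans n≤ (ℕ.≤-reflexive (cong (λ k → 2 ^ suc k) (length-reverse r)))

      length-word : length word ≡ suc (length r)
      length-word = trans (length-++ r) (ℕ.+-comm (length r) 1)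

      -- Rewinding takes one light symbol per letter and one more for the step into `sim`.
      spare : ℕ
      spare = lights ∸ suc (length word)

      lights-split : lights ≡ length word + suc spare
      lights-split = trans
        (sym (ℕ.m+[n∸m]≡n (ℕ.≤-trans (ℕ.≤-reflexive (cong suc length-word))
          (ℕ.≤-trans (n<2^n (suc (length r))) p≤lights))))
        (sym (ℕ.+-suc (length word) spare))

      -- The first n heavy symbols drive the simulation; the others are idled away.
      heavies-split : List.replicate p heavy ≡ List.replicate n heavy ++ List.replicate (p ∸ n) heavy ++ []
      heavies-split = trans (cong (λ k → List.replicate k heavy) (sym (ℕ.m+[n∸m]≡n n≤p)))
        (trans (replicate-+ n (p ∸ n) heavy) (cong (List.replicate n heavy ++_) (sym (++-identityʳ _))))

      heavies : List Symbol
      heavies = List.replicate n heavy ++ List.replicate (p ∸ n) heavy ++ []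

      clock-split : clock r ≡ List.replicate (length word) light ++ light ∷ List.replicate spare light ++ heavies
      clock-split = trans shape (trans
        (cong₂ _++_
          (trans (cong (λ k → List.replicate k light) lights-split) (replicate-+ (length word) (suc spare) light))
          heavies-split)
        (++-assoc (List.replicate (length word) light) _ heavies))

      generated-word : Working x rew (clock r) (code word ∷ code [] ∷ replicate _ [])
      generated-word = working (ℕ.+-identityʳ x) (generate r (there (here refl)))

      rewound : Working x rew (light ∷ List.replicate spare light ++ heavies) ([] ∷ code (wordOf r) ∷ replicate _ [])
      rewound = subst
        (λ w → Working x rew (light ∷ List.replicate spare light ++ heavies) ([] ∷ code w ∷ replicate _ []))
        (rewind-start r)
        (rewind word [] (replicate _ [])
          (subst (λ A → Working x rew A (code word ∷ code [] ∷ replicate _ [])) clock-split generated-word))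

      started : Working x (sim N.start) (List.replicate spare light ++ heavies) (interleave (inputTapes (wordOf r)))
      started = work-step (λ _ _ → refl) rewound (here refl)
        (cong ([] ∷_) (trans (update-nops (code (wordOf r) ∷ replicate _ []))
          (cong (code (wordOf r) ∷_) (sym (interleave-replicate N.nTapes-1 [])))))

      length-code : length (code (wordOf r)) ≡ suc (length r)
      length-code = cong suc (trans (length-map (enc M) (reverse r)) (length-reverse r))

      simulated : ∃ λ v → Bounded (suc (n + length r)) v × Working x (sim (state c)) (List.replicate (p ∸ n) heavy ++ []) v
      simulated = simulate (inputTapes (wordOf r)) run (holdsAll-initN (wordOf r))
        (z≤n ∷ ℕ.≤-reflexive length-code ∷ bounded-empty N.nTapes-1)
        (idle (List.replicate spare light) started)

      idled : Working x (sim (state c)) [] (proj₁ simulated)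
      idled = idle (List.replicate (p ∸ n) heavy) (proj₂ (proj₂ simulated))

      length-shape : x ≡ lights + p
      length-shape = trans (cong length shape) (trans (length-++ (List.replicate lights light))
        (cong₂ _+_ (length-replicate lights) (length-replicate p)))

      -- The word gives stacks of height at most |w|, and n steps add at most n. Here n is at most
      -- the number of light symbols and |w| at most that of heavy ones.
      enough : suc (n + length r) ≤ x
      enough = begin
        suc (n + length r) ≡⟨ ℕ.+-suc n (length r) ⟨
        n + suc (length r) ≤⟨ ℕ.+-mono-≤ (ℕ.≤-trans n≤p p≤lights)
                                (ℕ.≤-trans (ℕ.n≤1+n _) (n<2^n (suc (length r)))) ⟩
        lights + p         ≡⟨ length-shape ⟨
        x                  ∎
        where open ℕ.≤-Reasoning

      bounded : Bounded x (proj₁ simulated)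
      bounded = All.map (λ le → ℕ.≤-trans le enough) (proj₁ (proj₂ simulated))

      regroup : ∀ n → 8 * (n * 4) ≡ n * 32
      regroup = solve-∀

      time : 8 * x ≡ value r * 2 ^ 5
      time = trans (cong (8 *_) (length-clock r)) (regroup (value r))

-- From accepting times to padded words

pad-accepted : (L : List Bool → Set) → (∀ w → L w → ∃ λ bs → w ≡ true ∷ bs) → (M : NTM) →
  (∀ w → (L w → AcceptsWithin M w (2 ^ length w)) × (AcceptsWithin M w (2 ^ length w) → L w)) →
  (R : RealTime 5 (Simulation.machine M)) → let open RealTime R in ∀ u →
  (RTAccepts acceptor u → ∃ λ w → L w × u ≡ pad w) × ((∃ λ w → L w × u ≡ pad w) → RTAccepts acceptor u)
pad-accepted L L⊆1 M spec R u = sound , complete′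
  where
    open RealTime R
    open Simulation M using (AcceptsInTime; machine-sound; machine-complete)

    sound : RTAccepts acceptor u → ∃ λ w → L w × u ≡ pad w
    sound acc = let (r , accM , time) = machine-sound (accepts-only u acc) in
      wordOf r , proj₂ (spec (wordOf r)) accM ,
      -- Cancelling the factor 32 gives the length of `u`, which determines a unary word.
      unary-≡ (trans (ℕ.*-cancelʳ-≡ (length u) (value r) (2 ^ 5) time) (sym (length-pad r)))

    accepts : ∀ r → AcceptsInTime r → RTAccepts acceptor (pad (wordOf r))
    accepts r acc = let (v , len , accR) = accepts-all (value r) (machine-complete r acc) in
      subst (RTAccepts acceptor) (unary-≡ (trans len (sym (length-pad r)))) accR

    complete′ : (∃ λ w → L w × u ≡ pad w) → RTAccepts acceptor u
    complete′ (w , w∈L , refl) with L⊆1 w w∈L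
    -- `wordOf` expects the latest bit first, so `bs` is reversed.
    ... | bs , refl = subst (RTAccepts acceptor ∘ pad) wordOf-reverse
      (accepts (reverse bs)
        (subst (λ w → AcceptsWithin M w (2 ^ length w)) (sym wordOf-reverse) (proj₁ (spec w) w∈L)))
      where
        wordOf-reverse : wordOf (reverse bs) ≡ true ∷ bs
        wordOf-reverse = cong (true ∷_) (reverse-involutive bs)

theorem1 : (L : List Bool → Set)
    → (∀ w → L w → ∃ λ bs → w ≡ true ∷ bs)
    → InNTIME2^n L
    → Σ (RTM ⊤) λ M → ∀ u →
        (RTAccepts M u → ∃ λ w → L w × u ≡ pad w)
        × ((∃ λ w → L w × u ≡ pad w) → RTAccepts M u)
theorem1 L L⊆1 (M , spec) = RealTime.acceptor R , pad-accepted L L⊆1 M spec R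
  where
    R : RealTime 5 (Simulation.machine M)
    R = realTime 5 (Simulation.machine M)
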